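{- Let $w>0$ be an integer. If $w$ is even, let \[ d_w(z,q)=(1-z)\prod_{i=1}^{w}(1-z^i)\prod_{i=1}^{w/2}(1-q^{2i}z), \] and if $w$ is odd, let \[ d_w(z,q)=\prod_{i=1}^{w}(1-z^{2i})\prod_{i=1}^{(w+1)/2}(1-q^{2i-1}z). \] Then for every partition $\mu$ of $w$, the series $d_w(z,q)A_\mu(z,q)$ is an element of $\mathbb{Z}[z,q]$.
   Context: For $n\geqslant 0$ let $[n]_q=\frac{q^n-q^{ -n}}{q-q^{ -1}}$. For a partition $\mu$ and an integer $h\geqslant 0$, the Laurent polynomial $s_\mu(q^{ -h},q^{ -h+2},\ldots,q^{h})$ (Schur polynomial in $h+1$ variables) is invariant under $q\mapsto q^{ -1}$ and can be written uniquely as $\sum_{k\geqslant 1} a_{\mu[h]}^{[k]}[k]_q$ with integers $a_{\mu[h]}^{[k]}$. Define the formal power series $A_\mu(z,q)=\sum_{k\geqslant 1,\,h\geqslant 0} a_{\mu[h]}^{[k]}q^kz^h$. -}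

module Defs where

open import Data.Bool using (Bool; true; false; _∧_; if_then_else_)
open import Data.Nat as ℕ using (ℕ; zero; suc; _<ᵇ_; _≤ᵇ_; _%_; _/_)
open import Data.Integer as ℤ using (ℤ; +_; _-_; _*_; _+_; -_)
open import Data.Integer.Properties using () renaming (_≟_ to _≟ℤ_)
open import Data.List using (List; []; _∷_; map; concatMap; upTo; foldr; zipWith; length)
open import Data.Nat.ListAction using (sum)
open import Data.List.Relation.Unary.All using (All)
open import Data.List.Relation.Unary.Linked using (Linked)
open import Data.Product using (_×_; _,_)
open import Relation.Nullary.Decidable using (⌊_⌋)
open import Relation.Binary.PropositionalEquality using (_≡_)

IsPartitionOf : ℕ → List ℕ → Set
IsPartitionOf w μ = (sum μ ≡ w) × All (λ p → 0 ℕ.< p) μ × Linked ℕ._≥_ μ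

-- Fillings of the Young diagram of μ with entries in {0,…,h}
-- (a filling is the list of its rows, top row first).

rowsOf : ℕ → ℕ → List (List ℕ)
rowsOf h zero    = [] ∷ []
rowsOf h (suc n) = concatMap (λ x → map (x ∷_) (rowsOf h n)) (upTo (suc h))

fillings : ℕ → List ℕ → List (List (List ℕ))
fillings h []       = [] ∷ []
fillings h (l ∷ ls) = concatMap (λ r → map (r ∷_) (fillings h ls)) (rowsOf h l)

rowWeak : List ℕ → Bool
rowWeak []           = true
rowWeak (x ∷ [])     = true
rowWeak (x ∷ y ∷ xs) = (x ≤ᵇ y) ∧ rowWeak (y ∷ xs)

allB : List Bool → Bool
allB = foldr _∧_ true

colStrict : List ℕ → List ℕ → Bool       -- upper row r, lower (shorter) row r'
colStrict r r' = allB (zipWith _<ᵇ_ r r')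

isSSYT : List (List ℕ) → Bool
isSSYT []            = true
isSSYT (r ∷ [])      = rowWeak r
isSSYT (r ∷ r' ∷ rs) = rowWeak r ∧ colStrict r r' ∧ isSSYT (r' ∷ rs)

-- q-exponent of the monomial x^T under x_i = q^{-h+2i} (i = 0,…,h)
qWeight : ℕ → List (List ℕ) → ℤ
qWeight h T = sum′ (map (λ r → sum′ (map (λ t → (+ (2 ℕ.* t)) - (+ h)) r)) T)
  where
  sum′ : List ℤ → ℤ
  sum′ = foldr _+_ (+ 0)

count : {A : Set} → (A → Bool) → List A → ℕ
count p []       = 0
count p (x ∷ xs) = if p x then suc (count p xs) else count p xs

-- Coefficient of q^e in the Laurent polynomial s_μ(q^{-h}, q^{-h+2}, …, q^h),
-- the Schur polynomial in h+1 variables given as the sum over semistandard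
-- Young tableaux of shape μ with entries in {0,…,h}.
schurCoeff : List ℕ → ℕ → ℤ → ℤ
schurCoeff μ h e = + count (λ T → isSSYT T ∧ ⌊ qWeight h T ≟ℤ e ⌋) (fillings h μ)

-- Coefficient of q^e in [k]_q = (q^k - q^{-k})/(q - q^{-1})
--   = q^{k-1} + q^{k-3} + … + q^{-(k-1)}.
qintCoeff : ℕ → ℤ → ℤ
qintCoeff k e = + count (λ j → ⌊ ((+ k) - (+ 1)) - (+ (2 ℕ.* j)) ≟ℤ e ⌋) (upTo k)

sumFrom1 : ℕ → (ℕ → ℤ) → ℤ
sumFrom1 zero    f = + 0
sumFrom1 (suc K) f = sumFrom1 K f + f (suc K)

-- a : ℕ → ℕ → ℤ (a k h = a_{μ[h]}^{[k]}) is the expansion of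
-- s_μ(q^{-h},…,q^h) = Σ_{k≥1} a_{μ[h]}^{[k]} [k]_q  (a finite sum) for every h.
IsQIntExpansion : List ℕ → (ℕ → ℕ → ℤ) → Set
IsQIntExpansion μ a = (h : ℕ) → Data.Product.Σ ℕ λ K →
  ((k : ℕ) → K ℕ.< k → a k h ≡ + 0) ×
  ((e : ℤ) → schurCoeff μ h e ≡ sumFrom1 K (λ k → a k h * qintCoeff k e))

-- Coefficient of q^k z^h in A_μ(z,q) = Σ_{k≥1,h≥0} a_{μ[h]}^{[k]} q^k z^h.
Acoeff : (ℕ → ℕ → ℤ) → ℕ → ℕ → ℤ
Acoeff a zero    h = + 0
Acoeff a (suc k) h = a (suc k) h

-- Polynomials in q, z with integer coefficients as lists of terms
-- (c , i , j) standing for c q^i z^j.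

Poly : Set
Poly = List (ℤ × ℕ × ℕ)

_·_ : Poly → Poly → Poly
P · Q = concatMap (λ { (c , i , j) → map (λ { (d , i′ , j′) → (c * d , i ℕ.+ i′ , j ℕ.+ j′) }) Q }) P

one : Poly
one = (+ 1 , 0 , 0) ∷ []

binom : ℕ → ℕ → Poly
binom i j = (+ 1 , 0 , 0) ∷ (- (+ 1) , i , j) ∷ []

prodFrom1 : ℕ → (ℕ → Poly) → Poly
prodFrom1 zero    f = one
prodFrom1 (suc n) f = prodFrom1 n f · f (suc n)

d : ℕ → Poly
d w with w % 2
... | zero  = (binom 0 1 · prodFrom1 w (λ i → binom 0 i)) · prodFrom1 (w / 2) (λ i → binom (2 ℕ.* i) 1)
... | suc _ = prodFrom1 w (λ i → binom 0 (2 ℕ.* i)) · prodFrom1 ((w ℕ.+ 1) / 2) (λ i → binom (2 ℕ.* i ℕ.∸ 1) 1)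

-- Coefficient of q^k z^h in P · F, where F is a power series in q, z
-- given by its coefficient function (F k h = coefficient of q^k z^h).
mulSeriesCoeff : Poly → (ℕ → ℕ → ℤ) → ℕ → ℕ → ℤ
mulSeriesCoeff []                F k h = + 0
mulSeriesCoeff ((c , i , j) ∷ P) F k h =
  (if (i ≤ᵇ k) ∧ (j ≤ᵇ h) then c * F (k ℕ.∸ i) (h ℕ.∸ j) else + 0)
  + mulSeriesCoeff P F k h

IsPolynomial : (ℕ → ℕ → ℤ) → Set
IsPolynomial F = Data.Product.Σ ℕ λ N → (k h : ℕ) → (N ℕ.≤ k Data.Sum.⊎ N ℕ.≤ h) → F k h ≡ + 0
  where import Data.Sum

{-# OPTIONS --safe #-}
-- Let F(z,q) = Σ_h s_μ(q^{-h},…,q^h) z^h. Removing the zeros of a tableau and lowering its other entries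
-- by one gives, by induction on the number of cells, that Π_{m=0}^{w} (1 - q^{2m-w} z) F is a Laurent
-- polynomial; for the induction one replaces tableaux by words satisfying a condition that depends only
-- on the relative order of the letters. Moreover A_μ is the part of (q - q⁻¹) F of positive degree in q.
-- Write the denominator as D₊ D₀ D₋ according to the sign of the exponent of q, and put x = q² if w is
-- even, x = q if w is odd. Modulo a factor 1 - z x^i of D₊ and a factor 1 - z x^{-j} of D₋ one has
-- z^{i+j} = 1. Cancelling, at each step, the last factor of D₊ or of D₋ by means of this relation shows
-- that the ideal (D₊ , D₋) contains C = Π_s (1 - z^s), where each value s of i + j is needed only once.
-- Hence C D₀ (q - q⁻¹) F is the sum of a series with denominator D₊, whose nonpositive part is finite,
-- and one with denominator D₋, whose positive part is finite, so D₊ C D₀ A_μ is a polynomial; and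
-- d_w = D₊ C D₀, where for even w the product C also includes s = 1.
module Submission where

open import Defs
open import Algebra.Bundles using (CommutativeRing)
open import Data.Bool using (Bool; true; false; _∧_; if_then_else_)
open import Data.Bool.Properties using (∧-zeroʳ)
open import Data.Integer using (ℤ; +_; -[1+_]; +0; +[1+_]; 0ℤ; 1ℤ; -1ℤ; _+_; _-_; _*_; -_; _≤_; _⊔_; _⊖_; ∣_∣; +≤+; -≤+; +<+) renaming (_<_ to _<ℤ_)
open import Data.Integer.Properties
open import Data.Integer.Tactic.RingSolver using (solve-∀)
open import Data.List using (List; []; _∷_; _++_; map; concatMap; upTo; length; take; drop; foldr)
open import Data.List.Properties using (map-upTo; take-map; drop-map; length-take; length-drop; take++drop≡id)
open import Data.Maybe using (nothing)
open import Data.Nat using (ℕ; _<_)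
open import Data.Nat as ℕ using (zero; suc; z≤n; s≤s; _<ᵇ_; _≤ᵇ_; _%_; _/_)
open import Data.Nat.DivMod using (m≡m%n+[m/n]*n; m%n<n; m*n/n≡m)
open import Data.Nat.ListAction using (sum)
open import Data.Nat.ListAction.Properties using (sum-++)
import Data.Nat.Properties as ℕ
import Data.Nat.Tactic.RingSolver as ℕ-RingSolver
open import Data.Product using (∃; ∃₂; _×_; _,_; proj₁; proj₂)
open import Data.Sum using (_⊎_; inj₁; inj₂)
open import Function using (_∘_)
open import Level using (0ℓ)
open import Relation.Nullary using (Reflects; yes; no; ofʸ; ofⁿ; contradiction)
open import Relation.Nullary.Decidable using (⌊_⌋)
open import Relation.Nullary.Reflects using (det)
open import Relation.Binary.PropositionalEquality
import Tactic.RingSolver as RingSolver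
open import Tactic.RingSolver.Core.AlmostCommutativeRing using (AlmostCommutativeRing; fromCommutativeRing)

-- Laurent polynomials as operators on formal series

-- F e h is the coefficient of q^e z^h; allowing h < 0 makes multiplication by monomials a pure shift.
Series : Set
Series = ℤ → ℤ → ℤ

infix 4 _≐_
_≐_ : Series → Series → Set
F ≐ G = ∀ e h → F e h ≡ G e h

infixl 6 _∔_
_∔_ : Series → Series → Series
(F ∔ G) e h = F e h + G e h

-- Laurent polynomials in q and z; term c i j is c q^i z^j.
data Op : Set where
  term    : ℤ → ℤ → ℤ → Op
  _⊕_ _⊗_ : Op → Op → Op

infixl 6 _⊕_
infixl 7 _⊗_

act : Op → Series → Series
act (term c i j) F e h = c * F (e - i) (h - j)
act (P ⊕ Q)      F e h = act P F e h + act Q F e h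
act (P ⊗ Q)      F     = act P (act Q F)

act-cong : ∀ P {F G} → F ≐ G → act P F ≐ act P G
act-cong (term c i j) p e h = cong (c *_) (p (e - i) (h - j))
act-cong (P ⊕ Q)      p e h = cong₂ _+_ (act-cong P p e h) (act-cong Q p e h)
act-cong (P ⊗ Q)      p     = act-cong P (act-cong Q p)

interchange : ∀ a b c d → (a + b) + (c + d) ≡ (a + c) + (b + d)
interchange = solve-∀

act-∔ : ∀ P F G → act P (F ∔ G) ≐ act P F ∔ act P G
act-∔ (term c i j) F G e h = *-distribˡ-+ c (F (e - i) (h - j)) (G (e - i) (h - j))
act-∔ (P ⊕ Q)      F G e h =
  trans (cong₂ _+_ (act-∔ P F G e h) (act-∔ Q F G e h))
        (interchange (act P F e h) (act P G e h) (act Q F e h) (act Q G e h))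
act-∔ (P ⊗ Q)      F G e h =
  trans (act-cong P (act-∔ Q F G) e h) (act-∔ P (act Q F) (act Q G) e h)

minus-interchange : ∀ a b c d → a + b - (c + d) ≡ a - c + (b - d)
minus-interchange = solve-∀

i+j-j≡i : ∀ i j → i + j - j ≡ i
i+j-j≡i = solve-∀

i-[i+j]≡-j : ∀ i j → i - (i + j) ≡ - j
i-[i+j]≡-j = solve-∀

minus-+ : ∀ e i j → e - (i + j) ≡ e - i - j
minus-+ = solve-∀

minus-swap : ∀ e i j → (e - i) - j ≡ (e - j) - i
minus-swap = solve-∀

*-left-swap : ∀ c d x → c * (d * x) ≡ d * (c * x)
*-left-swap = solve-∀

act-term : ∀ P c i j F → act P (act (term c i j) F) ≐ act (term c i j) (act P F)
act-term (term d i′ j′) c i j F e h =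
  trans (cong₂ (λ x y → d * (c * F x y)) (minus-swap e i′ i) (minus-swap h j′ j))
        (*-left-swap d c _)
act-term (P ⊕ Q) c i j F e h =
  trans (cong₂ _+_ (act-term P c i j F e h) (act-term Q c i j F e h))
        (sym (*-distribˡ-+ c _ _))
act-term (P ⊗ Q) c i j F e h =
  trans (act-cong P (act-term Q c i j F) e h) (act-term P c i j (act Q F) e h)

act-comm : ∀ P Q F → act P (act Q F) ≐ act Q (act P F)
act-comm (term c i j) Q F e h = sym (act-term Q c i j F e h)
act-comm (P ⊕ P′) Q F e h =
  trans (cong₂ _+_ (act-comm P Q F e h) (act-comm P′ Q F e h))
        (sym (act-∔ Q (act P F) (act P′ F) e h))
act-comm (P ⊗ P′) Q F e h =
  trans (act-cong P (act-comm P′ Q F) e h) (act-comm P Q (act P′ F) e h)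

infix 4 _≋_
-- Equality of operators on all series, so the syntax needs no normal form; as a record it lets `P`
-- and `Q` be inferred.
record _≋_ (P Q : Op) : Set where
  constructor mk
  field ap : ∀ F → act P F ≐ act Q F
open _≋_

𝟘 𝟙 : Op
𝟘 = term 0ℤ 0ℤ 0ℤ
𝟙 = term 1ℤ 0ℤ 0ℤ

⊝_ : Op → Op
⊝ P = term -1ℤ 0ℤ 0ℤ ⊗ P

act-𝟙 : ∀ F → act 𝟙 F ≐ F
act-𝟙 F e h = trans (*-identityˡ _) (cong₂ F (+-identityʳ e) (+-identityʳ h))

act-⊝ : ∀ P F e h → act (⊝ P) F e h ≡ - act P F e h
act-⊝ P F e h = trans (-1*i≡-i _) (cong₂ (λ x y → - act P F x y) (+-identityʳ e) (+-identityʳ h))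

OpRing : CommutativeRing 0ℓ 0ℓ
OpRing = record
  { Carrier = Op ; _≈_ = _≋_ ; _+_ = _⊕_ ; _*_ = _⊗_ ; -_ = ⊝_ ; 0# = 𝟘 ; 1# = 𝟙
  ; isCommutativeRing = record
    { isRing = record
      { +-isAbelianGroup = record
        { isGroup = record
          { isMonoid = record
            { isSemigroup = record
              { isMagma = record
                { isEquivalence = record
                  { refl  = mk λ F e h → refl
                  ; sym   = λ p → mk λ F e h → sym (ap p F e h)
                  ; trans = λ p q → mk λ F e h → trans (ap p F e h) (ap q F e h) }
                ; ∙-cong = λ p q → mk λ F e h → cong₂ _+_ (ap p F e h) (ap q F e h) }
              ; assoc = λ P Q R → mk λ F e h → +-assoc (act P F e h) (act Q F e h) (act R F e h) }
            ; identity = (λ P → mk λ F e h → +-identityˡ (act P F e h))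
                       , (λ P → mk λ F e h → +-identityʳ (act P F e h)) }
          ; inverse = (λ P → mk λ F e h → trans (cong (_+ act P F e h) (act-⊝ P F e h)) (+-inverseˡ (act P F e h)))
                    , (λ P → mk λ F e h → trans (cong (_+_ (act P F e h)) (act-⊝ P F e h)) (+-inverseʳ (act P F e h)))
          ; ⁻¹-cong = λ p → mk λ F e h → cong (-1ℤ *_) (ap p F (e - 0ℤ) (h - 0ℤ)) }
        ; comm = λ P Q → mk λ F e h → +-comm (act P F e h) (act Q F e h) }
      ; *-cong = λ {P} {P′} {Q} {Q′} p q → mk λ F e h →
          trans (act-cong P (ap q F) e h) (ap p (act Q′ F) e h)
      ; *-assoc = λ P Q R → mk λ F e h → refl
      ; *-identity = (λ P → mk λ F e h → act-𝟙 (act P F) e h)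
                   , (λ P → mk λ F e h → act-cong P (act-𝟙 F) e h)
      ; distrib = (λ P Q R → mk λ F e h → act-∔ P (act Q F) (act R F) e h)
                , (λ P Q R → mk λ F e h → refl) }
    ; *-comm = λ P Q → mk λ F e h → act-comm P Q F e h } }

OpACR : AlmostCommutativeRing 0ℓ 0ℓ
OpACR = fromCommutativeRing OpRing (λ _ → nothing)

module O = CommutativeRing OpRing

module OpSolver where
  open AlmostCommutativeRing OpACR using (_≈_) renaming (_+_ to _⊞_; _*_ to _⊠_)

  combine : ∀ a b P Q u v α β γ δ →
    (u ⊠ a) ⊠ ((α ⊠ P) ⊞ (β ⊠ (Q ⊠ b))) ⊞ (v ⊠ b) ⊠ ((γ ⊠ (P ⊠ a)) ⊞ (δ ⊠ Q)) ≈
    ((u ⊠ α) ⊞ ((v ⊠ b) ⊠ γ)) ⊠ (P ⊠ a) ⊞ (((u ⊠ a) ⊠ β) ⊞ (v ⊠ δ)) ⊠ (Q ⊠ b)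
  combine = RingSolver.solve-∀ OpACR

-- Ideals generated by two elements

bin : ℤ → ℤ → Op
bin i j = 𝟙 ⊕ term -1ℤ i j

∏ : ℕ → (ℕ → Op) → Op
∏ zero    f = 𝟙
∏ (suc n) f = ∏ n f ⊗ f n

infix 4 _∈⟨_,_⟩
_∈⟨_,_⟩ : Op → Op → Op → Set
c ∈⟨ P , Q ⟩ = ∃₂ λ u v → c ≋ u ⊗ P ⊕ v ⊗ Q

-- Write `c = u a + v b`. The summand `u a` supplies the `a` missing from `⟨ P , Q ⊗ b ⟩`, and `v b`
-- supplies the `b` missing from `⟨ P ⊗ a , Q ⟩`.
∈-combine : ∀ {a b c e P Q} → c ∈⟨ a , b ⟩ → e ∈⟨ P , Q ⊗ b ⟩ → e ∈⟨ P ⊗ a , Q ⟩ →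
            c ⊗ e ∈⟨ P ⊗ a , Q ⊗ b ⟩
∈-combine {a} {b} {c} {e} {P} {Q} (u , v , c≋) (α , β , e≋) (γ , δ , e≋′) =
  _ , _ , O.trans (O.trans (O.*-congʳ c≋)
                           (O.trans (O.distribʳ e (u ⊗ a) (v ⊗ b))
                                    (O.+-cong (O.*-congˡ {u ⊗ a} e≋) (O.*-congˡ {v ⊗ b} e≋′))))
                  (OpSolver.combine a b P Q u v α β γ δ)

∈-cong : ∀ {c e P Q} → c ≋ e → e ∈⟨ P , Q ⟩ → c ∈⟨ P , Q ⟩
∈-cong c≋e (u , v , p) = u , v , O.trans c≋e p

-- The quotient of C (i+1) (j+1) by C i (j+1) ≋ C (i+1) j lies in (a i , b j), and multiplying by it
-- removes the last factor of one of the two products.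
∏-comaximal : (a b : ℕ → Op) (C : ℕ → ℕ → Op) →
  (∀ i j → ∃ λ c → c ∈⟨ a i , b j ⟩ × C (suc i) (suc j) ≋ c ⊗ C i (suc j) × C i (suc j) ≋ C (suc i) j) →
  ∀ i j → C i j ∈⟨ ∏ i a , ∏ j b ⟩
∏-comaximal a b C step zero j = C 0 j , 𝟘 ,
  O.sym {C 0 j ⊗ 𝟙 ⊕ 𝟘 ⊗ ∏ j b} (O.trans (O.+-cong (O.*-identityʳ (C 0 j)) (O.zeroˡ (∏ j b))) (O.+-identityʳ (C 0 j)))
∏-comaximal a b C step (suc i) zero = 𝟘 , C (suc i) 0 ,
  O.sym {𝟘 ⊗ ∏ (suc i) a ⊕ C (suc i) 0 ⊗ 𝟙}
    (O.trans (O.+-cong (O.zeroˡ (∏ (suc i) a)) (O.*-identityʳ (C (suc i) 0))) (O.+-identityˡ (C (suc i) 0)))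
∏-comaximal a b C step (suc i) (suc j) =
  let c , c∈ , C≋ , C≋′ = step i j
  in ∈-cong C≋ (∈-combine {a i} {b j} {c} {C i (suc j)} {∏ i a} {∏ j b} c∈
       (∏-comaximal a b C step i (suc j)) (∈-cong C≋′ (∏-comaximal a b C step (suc i) j)))

-- The first monomial is subtracted and added back. This yields both the divisibility of 1 - m^n by
-- 1 - m and the combination of two congruences m = 1 and m' = 1 into m m' = 1.
bin-+ : ∀ x y i j → bin (x + i) (y + j) ≋ bin x y ⊕ term 1ℤ x y ⊗ bin i j
bin-+ x y i j = mk λ F e h →
  trans (cong (λ t → 1ℤ * F (e - 0ℤ) (h - 0ℤ) + -1ℤ * t) (cong₂ F (minus-+ e x i) (minus-+ h y j)))
  (trans (expand (F (e - 0ℤ) (h - 0ℤ)) (F (e - x) (h - y)) (F (e - x - i) (h - y - j)))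
  (cong (λ t → 1ℤ * F (e - 0ℤ) (h - 0ℤ) + -1ℤ * F (e - x) (h - y) + 1ℤ * (1ℤ * t + -1ℤ * F (e - x - i) (h - y - j)))
        (cong₂ F (sym (+-identityʳ (e - x))) (sym (+-identityʳ (h - y))))))
  where
  expand : ∀ a b c → 1ℤ * a + -1ℤ * c ≡ 1ℤ * a + -1ℤ * b + 1ℤ * (1ℤ * b + -1ℤ * c)
  expand = solve-∀

bin-00 : bin 0ℤ 0ℤ ≋ 𝟘
bin-00 = mk λ F e h → cancel (F (e - 0ℤ) (h - 0ℤ))
  where
  cancel : ∀ a → 1ℤ * a + -1ℤ * a ≡ 0ℤ * a
  cancel = solve-∀

-- The cofactor `u` is the geometric sum 1 + m + ... + m^(n-1) of the monomial m = q^i z^j.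
bin-multiple : ∀ n i j → ∃ λ u → bin (+ n * i) (+ n * j) ≋ u ⊗ bin i j
bin-multiple zero    i j = 𝟘 , O.trans bin-00 (O.sym (O.zeroˡ _))
bin-multiple (suc n) i j with bin-multiple n i j
... | u , p = u ⊕ term 1ℤ (+ n * i) (+ n * j) ,
  O.trans (O.reflexive (cong₂ bin (step n i) (step n j)))
  (O.trans (bin-+ (+ n * i) (+ n * j) i j)
  (O.trans (O.+-congʳ p) (O.sym (O.distribʳ (bin i j) u _))))
  where
  step : ∀ n i → + suc n * i ≡ + n * i + i
  step n i = trans (suc-* (+ n) i) (+-comm i (+ n * i))

-- Modulo the ideal, z^b x^{ab} = 1 and z^a x^{-ab} = 1.
bin-bezout : ∀ s a b → bin 0ℤ (+ (a ℕ.+ b)) ∈⟨ bin (s * + a) 1ℤ , bin (- (s * + b)) 1ℤ ⟩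
bin-bezout s a b with bin-multiple b (s * + a) 1ℤ | bin-multiple a (- (s * + b)) 1ℤ
... | u , p | v , r = u , term 1ℤ (+ b * (s * + a)) (+ b * 1ℤ) ⊗ v ,
  O.trans (O.reflexive (cong₂ bin (sym (cancel s (+ a) (+ b))) (sym (add (+ a) (+ b)))))
  (O.trans (bin-+ (+ b * (s * + a)) (+ b * 1ℤ) (+ a * (- (s * + b))) (+ a * 1ℤ))
  (O.+-cong p (O.trans (O.*-congˡ {term 1ℤ (+ b * (s * + a)) (+ b * 1ℤ)} r) (O.sym (O.*-assoc _ v _)))))
  where
  cancel : ∀ s a b → b * (s * a) + a * (- (s * b)) ≡ 0ℤ
  cancel = solve-∀
  add : ∀ a b → b * 1ℤ + a * 1ℤ ≡ a + b
  add = solve-∀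

-- Half-planes containing the support of a series

record Bdd (α β : ℤ) (F : Series) : Set where
  constructor bdd
  field
    bound    : ℤ
    vanishes : ∀ e h → bound <ℤ α * e + β * h → F e h ≡ 0ℤ

-- Upper bounds only: coefficients are finally read at natural exponents, where these two bounds
-- leave finitely many.
Bounded : Series → Set
Bounded F = Bdd 1ℤ 0ℤ F × Bdd 0ℤ 1ℤ F

Bdd-cong : ∀ {α β F G} → F ≐ G → Bdd α β F → Bdd α β G
Bdd-cong p (bdd K v) = bdd K λ e h l → trans (sym (p e h)) (v e h l)

Bdd-∔ : ∀ {α β F G} → Bdd α β F → Bdd α β G → Bdd α β (F ∔ G)
Bdd-∔ (bdd K v) (bdd L w) = bdd (K ⊔ L) λ e h l →
  cong₂ _+_ (v e h (≤-<-trans (i≤i⊔j K L) l)) (w e h (≤-<-trans (i≤j⊔i K L) l))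

Bdd-act : ∀ P {α β F} → Bdd α β F → Bdd α β (act P F)
Bdd-act (term c i j) {α} {β} (bdd K v) = bdd (K + (α * i + β * j)) λ e h l →
  trans (cong (c *_) (v (e - i) (h - j)
          (subst₂ _<ℤ_ (i+j-j≡i K (α * i + β * j)) (regroup α β e h i j)
            (+-monoˡ-< (- (α * i + β * j)) l))))
        (*-zeroʳ c)
  where
  regroup : ∀ α β e h i j → α * e + β * h - (α * i + β * j) ≡ α * (e - i) + β * (h - j)
  regroup = solve-∀
Bdd-act (P ⊕ Q) b = Bdd-∔ (Bdd-act P b) (Bdd-act Q b)
Bdd-act (P ⊗ Q) b = Bdd-act P (Bdd-act Q b)

-- A point beyond the summed bound is beyond one of the two given bounds, and either one forces the
-- coefficient to vanish. This converts bounds in oblique directions into bounds on `e` and `h`.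
Bdd-+ : ∀ {α β α′ β′ F} → Bdd α β F → Bdd α′ β′ F → Bdd (α + α′) (β + β′) F
Bdd-+ {α} {β} {α′} {β′} (bdd K v) (bdd L w) = bdd (K + L) vanish
  where
  regroup : ∀ α β α′ β′ e h → (α + α′) * e + (β + β′) * h ≡ (α * e + β * h) + (α′ * e + β′ * h)
  regroup = solve-∀
  vanish : ∀ e h → K + L <ℤ (α + α′) * e + (β + β′) * h → _
  vanish e h l with K <? α * e + β * h | L <? α′ * e + β′ * h
  ... | yes p | _     = v e h p
  ... | no _  | yes p = w e h p
  ... | no p  | no q  = contradiction
    (<-≤-trans (subst (K + L <ℤ_) (regroup α β α′ β′ e h) l) (+-mono-≤ (≮⇒≥ p) (≮⇒≥ q)))
    (<-irrefl refl)

i≤+∣i∣ : ∀ i → i ≤ + ∣ i ∣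
i≤+∣i∣ (+ n)    = ≤-refl
i≤+∣i∣ -[1+ n ] = -≤+

-- Unroll Y e h = N e h + Y (e - a) (h - 1), with N = (1 - q^a z) Y, until h leaves the support.
Bdd-divide : ∀ {α β Y} a → α * a + β * 1ℤ ≤ 0ℤ → Bdd 0ℤ -1ℤ Y → Bdd α β (act (bin a 1ℤ) Y) → Bdd α β Y
Bdd-divide {α} {β} {Y} a neg (bdd L below) (bdd K v) = bdd K λ e h → go (suc ∣ h + L ∣) e h
    (≤-<-trans (i≤+∣i∣ (h + L)) (+<+ (ℕ.n<1+n _)))
  where
  N : Series
  N = act (bin a 1ℤ) Y
  unroll : ∀ e h → Y e h ≡ N e h + Y (e - a) (h - 1ℤ)
  unroll e h = trans (cong₂ Y (sym (+-identityʳ e)) (sym (+-identityʳ h)))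
    (arith (Y (e - 0ℤ) (h - 0ℤ)) (Y (e - a) (h - 1ℤ)))
    where
    arith : ∀ x y → x ≡ 1ℤ * x + -1ℤ * y + y
    arith = solve-∀
  go : ∀ n e h → h + L <ℤ + n → K <ℤ α * e + β * h → Y e h ≡ 0ℤ
  go zero e h l _ = below e h
    (subst₂ _<ℤ_ (eq₁ h L) (eq₂ e h) (+-monoˡ-< (- h) l))
    where
    eq₁ : ∀ h L → h + L - h ≡ L
    eq₁ = solve-∀
    eq₂ : ∀ e h → 0ℤ - h ≡ 0ℤ * e + -1ℤ * h
    eq₂ = solve-∀
  go (suc n) e h l k = trans (unroll e h) (cong₂ _+_ (v e h k)
    (go n (e - a) (h - 1ℤ)
      (subst₂ _<ℤ_ (eq₁ h L) (eq₂ (+ n)) (+-monoˡ-< -1ℤ l))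
      -- By `neg`, moving to `(e - a , h - 1)` does not decrease `α e + β h`, so the point stays
      -- beyond `K`.
      (<-≤-trans k (subst₂ _≤_ (+-identityʳ _) (eq₃ α β a e h)
        (+-monoʳ-≤ (α * e + β * h) (neg-mono-≤ neg))))))
    where
    eq₁ : ∀ h L → h + L + -1ℤ ≡ h - 1ℤ + L
    eq₁ = solve-∀
    eq₂ : ∀ n → 1ℤ + n + -1ℤ ≡ n
    eq₂ = solve-∀
    eq₃ : ∀ α β a e h → α * e + β * h - (α * a + β * 1ℤ) ≡ α * (e - a) + β * (h - 1ℤ)
    eq₃ = solve-∀

Bdd-divide-∏ : ∀ {α β} (a : ℕ → ℤ) n {Y} → (∀ i → α * a i + β * 1ℤ ≤ 0ℤ) → Bdd 0ℤ -1ℤ Y →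
  Bdd α β (act (∏ n (λ i → bin (a i) 1ℤ)) Y) → Bdd α β Y
Bdd-divide-∏ a zero    {Y} neg below b = Bdd-cong (act-𝟙 Y) b
Bdd-divide-∏ {α} {β} a (suc n) neg below b = Bdd-divide {α} {β} (a n) (neg n) below
  (Bdd-divide-∏ {α} {β} a n neg (Bdd-act (bin (a n) 1ℤ) below) b)

-- Positive parts in q and the splitting argument

π : Series → Series
π F +[1+ n ] h = F +[1+ n ] h
π F +0       h = 0ℤ
π F -[1+ n ] h = 0ℤ

ρ : Series → Series
ρ F +[1+ n ] h = 0ℤ
ρ F +0       h = F +0 h
ρ F -[1+ n ] h = F -[1+ n ] h

π-cong : ∀ {F G} → F ≐ G → π F ≐ π G
π-cong p +[1+ n ] h = p +[1+ n ] h
π-cong p +0       h = refl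
π-cong p -[1+ n ] h = refl

π-∔ : ∀ F G → π (F ∔ G) ≐ π F ∔ π G
π-∔ F G +[1+ n ] h = refl
π-∔ F G +0       h = refl
π-∔ F G -[1+ n ] h = refl

π≐-ρ : ∀ F → π F ≐ F ∔ act (⊝ 𝟙) (ρ F)
π≐-ρ F e h = trans (split e) (cong (_+_ (F e h)) (sym (trans (act-⊝ 𝟙 (ρ F) e h) (cong -_ (act-𝟙 (ρ F) e h)))))
  where
  split : ∀ e → π F e h ≡ F e h - ρ F e h
  split +[1+ n ] = sym (+-identityʳ _)
  split +0       = sym (+-inverseʳ (F +0 h))
  split -[1+ n ] = sym (+-inverseʳ (F -[1+ n ] h))

Bdd-π : ∀ {α β F} → Bdd α β F → Bdd α β (π F)
Bdd-π (bdd K v) = bdd K λ { +[1+ n ] h l → v +[1+ n ] h l ; +0 h l → refl ; -[1+ n ] h l → refl }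

Bdd-ρ : ∀ {α β F} → Bdd α β F → Bdd α β (ρ F)
Bdd-ρ (bdd K v) = bdd K λ { +[1+ n ] h l → refl ; +0 h l → v +0 h l ; -[1+ n ] h l → v -[1+ n ] h l }

π-bounded : ∀ {F} → Bdd -1ℤ 0ℤ (π F)
π-bounded = bdd 0ℤ λ { +[1+ n ] h l → contradiction (subst (0ℤ <ℤ_) (eq +[1+ n ] h) l) λ ()
                     ; +0       h l → refl
                     ; -[1+ n ] h l → refl }
  where
  eq : ∀ e h → -1ℤ * e + 0ℤ * h ≡ - e
  eq = solve-∀

ρ-bounded : ∀ {F} → Bdd 1ℤ 0ℤ (ρ F)
ρ-bounded = bdd 0ℤ λ { +[1+ n ] h l → refl
                     ; +0       h l → contradiction (subst (0ℤ <ℤ_) (eq +0 h) l) (<-irrefl refl)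
                     ; -[1+ n ] h l → contradiction (subst (0ℤ <ℤ_) (eq -[1+ n ] h) l) λ () }
  where
  eq : ∀ e h → 1ℤ * e + 0ℤ * h ≡ e
  eq = solve-∀

-- Shared by polynomials in `z` alone, which do not move exponents of `q`; the factors of `D₊` lack
-- it and must stay outside `π`.
Preservesπ : Op → Set
Preservesπ P = ∀ F → act P (π F) ≐ π (act P F)

preserves-bin : ∀ j → Preservesπ (bin 0ℤ j)
preserves-bin j F e h rewrite +-identityʳ e with e
... | +[1+ n ] rewrite ℕ.+-identityʳ n = refl
... | +0       = refl
... | -[1+ n ] = refl

preserves-⊗ : ∀ {P Q} → Preservesπ P → Preservesπ Q → Preservesπ (P ⊗ Q)
preserves-⊗ {P} {Q} p q F e h = trans (act-cong P (q F) e h) (p (act Q F) e h)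

preserves-𝟙 : Preservesπ 𝟙
preserves-𝟙 F e h = trans (act-𝟙 (π F) e h) (sym (π-cong (act-𝟙 F) e h))

preserves-∏ : ∀ n {f} → (∀ i → Preservesπ (f i)) → Preservesπ (∏ n f)
preserves-∏ zero    p = preserves-𝟙
preserves-∏ (suc n) {f} p = preserves-⊗ {∏ n f} {f n} (preserves-∏ n p) (p n)

-- `B` stands for `(q - q⁻¹) F`; the exponents `p` and `m` are abstract so that both parities of `w`
-- are covered.
module PositivePart
  (p m : ℕ → ℤ) (p≥1 : ∀ i → 1ℤ ≤ p i) (m≤-1 : ∀ i → m i ≤ -1ℤ) (k l : ℕ)
  (D₀ C : Op) (pres : Preservesπ (D₀ ⊗ C))
  (C∈ : C ∈⟨ ∏ k (λ i → bin (p i) 1ℤ) , ∏ l (λ i → bin (m i) 1ℤ) ⟩)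
  (B : Series) (below : Bdd 0ℤ -1ℤ B)
  where

  D₊ D₋ U V : Op
  D₊ = ∏ k (λ i → bin (p i) 1ℤ)
  D₋ = ∏ l (λ i → bin (m i) 1ℤ)
  U  = proj₁ C∈
  V  = proj₁ (proj₂ C∈)

  -- X₋ has only D₋ as denominator, so its positive part is finite; X₊ has only D₊.
  X₋ X₊ : Series
  X₋ = act (U ⊗ D₀ ⊗ D₊) B
  X₊ = act (V ⊗ D₀ ⊗ D₋) B

  split : act (D₀ ⊗ C) B ≐ X₋ ∔ X₊
  split = ap eq B
    where
    swap : ∀ P Q → D₀ ⊗ (P ⊗ Q) ≋ P ⊗ D₀ ⊗ Q
    swap P Q = mk λ F → act-comm D₀ P (act Q F)
    eq : D₀ ⊗ C ≋ U ⊗ D₀ ⊗ D₊ ⊕ V ⊗ D₀ ⊗ D₋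
    eq = O.trans (O.*-congˡ {D₀} (proj₂ (proj₂ C∈)))
         (O.trans (O.distribˡ D₀ (U ⊗ D₊) (V ⊗ D₋))
         (O.+-cong (swap U D₊) (swap V D₋)))

  -- A bound in every direction means finite support: the full denominator turns `B` into a Laurent
  -- polynomial.
  module _ (fin : ∀ α β → Bdd α β (act (D₊ ⊗ D₀ ⊗ D₋) B)) where

    -- A factor of `D₋` shifts by `(m i , 1)` with `m i ≤ -1`, which never raises `e + h`; dividing
    -- a Laurent polynomial by `D₋` therefore keeps `e + h` bounded above.
    X₋-Bdd : Bdd 1ℤ 1ℤ X₋
    X₋-Bdd = Bdd-act U (Bdd-divide-∏ {1ℤ} {1ℤ} m l
      (λ i → +-monoˡ-≤ 1ℤ (subst (_≤ -1ℤ) (sym (*-identityˡ (m i))) (m≤-1 i)))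
      (Bdd-act (D₀ ⊗ D₊) below)
      (Bdd-cong (ap eq B) (fin 1ℤ 1ℤ)))
      where
      eq : D₊ ⊗ D₀ ⊗ D₋ ≋ D₋ ⊗ (D₀ ⊗ D₊)
      eq = O.trans (O.*-comm (D₊ ⊗ D₀) D₋) (O.*-congˡ {D₋} (O.*-comm D₊ D₀))

    -- The mirror image: shifts by `(p i , 1)` with `p i ≥ 1` never raise `h - e`.
    X₊-Bdd : Bdd -1ℤ 1ℤ X₊
    X₊-Bdd = Bdd-act V (Bdd-divide-∏ { -1ℤ} {1ℤ} p k
      (λ i → +-monoˡ-≤ 1ℤ (subst (_≤ -1ℤ) (sym (-1*i≡-i (p i))) (neg-mono-≤ (p≥1 i))))
      (Bdd-act (D₀ ⊗ D₋) below) (fin -1ℤ 1ℤ))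

    D₊X₊-fin : ∀ α β → Bdd α β (act D₊ X₊)
    D₊X₊-fin α β = Bdd-cong (ap eq B) (Bdd-act V (fin α β))
      where
      eq : V ⊗ (D₊ ⊗ D₀ ⊗ D₋) ≋ D₊ ⊗ (V ⊗ D₀ ⊗ D₋)
      eq = mk λ F → act-comm V D₊ (act (D₀ ⊗ D₋) F)

    -- With `e + h` bounded above, the lower bound on `h` bounds `e`, and positivity of `e` bounds
    -- `h`.
    πX₋-bounded : Bounded (π X₋)
    πX₋-bounded = Bdd-+ (Bdd-π X₋-Bdd) (Bdd-π (Bdd-act (U ⊗ D₀ ⊗ D₊) below)) , Bdd-+ (Bdd-π X₋-Bdd) π-bounded

    -- Here `h - e` is bounded above and `e ≤ 0`, hence `h` is bounded above.
    ρX₊-bounded : Bounded (ρ X₊)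
    ρX₊-bounded = ρ-bounded , Bdd-+ (Bdd-ρ X₊-Bdd) ρ-bounded

    -- `D₀ C` passes through `π`, giving `π X₋ + π X₊`. The second term may be infinite, but
    -- `π X₊ = X₊ - ρ X₊`, where `D₊` makes `X₊` a Laurent polynomial and `ρ X₊` is already bounded.
    act-π-Bdd : ∀ {α β} → Bdd α β (π X₋) → Bdd α β (ρ X₊) → Bdd α β (act (D₊ ⊗ (D₀ ⊗ C)) (π B))
    act-π-Bdd {α} {β} b₋ b₊ =
      Bdd-cong (λ e h → sym (trans (act-cong D₊ toπ e h) (act-∔ D₊ (π X₋) (π X₊) e h)))
        (Bdd-∔ (Bdd-act D₊ b₋)
          (Bdd-cong (λ e h → sym (trans (act-cong D₊ (π≐-ρ X₊) e h) (act-∔ D₊ X₊ _ e h)))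
            (Bdd-∔ (D₊X₊-fin α β) (Bdd-act (D₊ ⊗ ⊝ 𝟙) b₊))))
      where
      toπ : act (D₀ ⊗ C) (π B) ≐ π X₋ ∔ π X₊
      toπ e h = trans (pres B e h) (trans (π-cong split e h) (π-∔ X₋ X₊ e h))

    positivePart-bounded : Bounded (act (D₊ ⊗ (D₀ ⊗ C)) (π B))
    positivePart-bounded =
      act-π-Bdd (proj₁ πX₋-bounded) (proj₁ ρX₊-bounded) , act-π-Bdd (proj₂ πX₋-bounded) (proj₂ ρX₊-bounded)

-- Words and their order patterns

∑ : {A : Set} → List A → (A → ℤ) → ℤ
∑ []       f = 0ℤ
∑ (x ∷ xs) f = f x + ∑ xs f

∑-cong : {A : Set} (xs : List A) {f g : A → ℤ} → (∀ x → f x ≡ g x) → ∑ xs f ≡ ∑ xs g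
∑-cong []       p = refl
∑-cong (x ∷ xs) p = cong₂ _+_ (p x) (∑-cong xs p)

∑-zero : {A : Set} (xs : List A) → ∑ xs (λ _ → 0ℤ) ≡ 0ℤ
∑-zero []       = refl
∑-zero (x ∷ xs) = trans (+-identityˡ _) (∑-zero xs)

∑-++ : {A : Set} (xs ys : List A) (f : A → ℤ) → ∑ (xs ++ ys) f ≡ ∑ xs f + ∑ ys f
∑-++ []       ys f = sym (+-identityˡ _)
∑-++ (x ∷ xs) ys f = trans (cong (_+_ (f x)) (∑-++ xs ys f)) (sym (+-assoc (f x) (∑ xs f) (∑ ys f)))

∑-map : {A B : Set} (g : A → B) (xs : List A) (f : B → ℤ) → ∑ (map g xs) f ≡ ∑ xs (f ∘ g)
∑-map g []       f = refl
∑-map g (x ∷ xs) f = cong (_+_ (f (g x))) (∑-map g xs f)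

∑-concatMap : {A B : Set} (g : A → List B) (xs : List A) (f : B → ℤ) →
  ∑ (concatMap g xs) f ≡ ∑ xs (λ x → ∑ (g x) f)
∑-concatMap g []       f = refl
∑-concatMap g (x ∷ xs) f = trans (∑-++ (g x) (concatMap g xs) f) (cong (_+_ (∑ (g x) f)) (∑-concatMap g xs f))

∑-+ : {A : Set} (xs : List A) (f g : A → ℤ) → ∑ xs (λ x → f x + g x) ≡ ∑ xs f + ∑ xs g
∑-+ []       f g = refl
∑-+ (x ∷ xs) f g = trans (cong (_+_ (f x + g x)) (∑-+ xs f g)) (interchange (f x) (g x) (∑ xs f) (∑ xs g))

∑-swap : {A B : Set} (xs : List A) (ys : List B) (f : A → B → ℤ) →
  ∑ xs (λ x → ∑ ys (f x)) ≡ ∑ ys (λ y → ∑ xs (λ x → f x y))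
∑-swap []       ys f = sym (∑-zero ys)
∑-swap (x ∷ xs) ys f = trans (cong (_+_ (∑ ys (f x))) (∑-swap xs ys f)) (sym (∑-+ ys (f x) _))

∑-upTo-suc : ∀ n (f : ℕ → ℤ) → ∑ (upTo (suc n)) f ≡ f 0 + ∑ (upTo n) (f ∘ suc)
∑-upTo-suc n f = cong (_+_ (f 0)) (trans (cong (λ xs → ∑ xs f) (sym (map-upTo suc n))) (∑-map suc (upTo n) f))

∑-rowsOf-suc : ∀ h n (f : List ℕ → ℤ) →
  ∑ (rowsOf h (suc n)) f ≡ ∑ (upTo (suc h)) (λ x → ∑ (rowsOf h n) (λ v → f (x ∷ v)))
∑-rowsOf-suc h n f = trans (∑-concatMap (λ x → map (x ∷_) (rowsOf h n)) (upTo (suc h)) f)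
  (∑-cong (upTo (suc h)) (λ x → ∑-map (x ∷_) (rowsOf h n) f))

∑-rowsOf-cong : ∀ h n {f g : List ℕ → ℤ} → (∀ v → length v ≡ n → f v ≡ g v) →
  ∑ (rowsOf h n) f ≡ ∑ (rowsOf h n) g
∑-rowsOf-cong h zero    p = cong (_+ 0ℤ) (p [] refl)
∑-rowsOf-cong h (suc n) {f} {g} p = trans (∑-rowsOf-suc h n f)
  (trans (∑-cong (upTo (suc h)) (λ x → ∑-rowsOf-cong h n (λ v q → p (x ∷ v) (cong suc q))))
         (sym (∑-rowsOf-suc h n g)))

-- Which letters of a word of length n vanish; the m others form a word of length m.
data Pattern : ℕ → ℕ → Set where
  positive : ∀ {n} → Pattern n n
  0∷_      : ∀ {n m} → Pattern n m → Pattern (suc n) m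
  +∷_      : ∀ {n m} → Pattern n m → Pattern (suc n) (suc m)

fill : ∀ {n m} → Pattern n m → List ℕ → List ℕ
fill positive v       = map suc v
fill (0∷ S)   v       = 0 ∷ fill S v
fill (+∷ S)   []      = []
fill (+∷ S)   (x ∷ v) = suc x ∷ fill S v

ProperPattern : ℕ → Set
ProperPattern n = ∃ λ m → m ℕ.< n × Pattern n m

-- One pattern for each nonempty set of zero positions: `positive` occurs only directly after a
-- `0∷`, which rules out repetitions. The bound `m < n` supports recursion on the word length.
properPatterns : ∀ n → List (ProperPattern n)
properPatterns zero    = []
properPatterns (suc n) =
  (n , ℕ.≤-refl , 0∷ positive) ∷
  (map (λ { (m , m<n , S) → m , ℕ.m<n⇒m<1+n m<n , 0∷ S }) (properPatterns n) ++
   map (λ { (m , m<n , S) → suc m , s≤s m<n , +∷ S }) (properPatterns n))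

-- Words are sorted by the positions of their zeros, by induction on the length with a split on the
-- first letter. Words without zeros keep length `n` and stand apart: they give the recursion in `h`
-- that becomes the factor 1 - q^(2n-w) z.
∑-rowsOf-split : ∀ h n (f : List ℕ → ℤ) →
  ∑ (rowsOf (suc h) n) f ≡ ∑ (rowsOf h n) (f ∘ map suc) +
    ∑ (properPatterns n) (λ (m , _ , S) → ∑ (rowsOf h m) (f ∘ fill S))
∑-rowsOf-split h zero    f = sym (+-identityʳ _)
∑-rowsOf-split h (suc n) f = begin
  ∑ (rowsOf (suc h) (suc n)) f
    ≡⟨ ∑-rowsOf-suc (suc h) n f ⟩
  ∑ (upTo (suc (suc h))) (λ x → ∑ (rowsOf (suc h) n) (λ v → f (x ∷ v)))
    ≡⟨ ∑-upTo-suc (suc h) (λ x → ∑ (rowsOf (suc h) n) (λ v → f (x ∷ v))) ⟩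
  ∑ (rowsOf (suc h) n) (f ∘ (0 ∷_)) + ∑ X (λ x → ∑ (rowsOf (suc h) n) (f ∘ (suc x ∷_)))
    ≡⟨ cong₂ _+_ (∑-rowsOf-split h n (f ∘ (0 ∷_)))
         (trans (∑-cong X λ x → ∑-rowsOf-split h n (f ∘ (suc x ∷_))) (∑-+ X g₁ g₂)) ⟩
  (a₀ + b₀) + (∑ X g₁ + ∑ X g₂)
    ≡⟨ cong₂ (λ s t → (a₀ + b₀) + (s + t)) (sym (∑-rowsOf-suc h n (f ∘ map suc)))
         (trans (∑-swap X Q _) (∑-cong Q λ (m , _ , S) → sym (∑-rowsOf-suc h m (f ∘ fill (+∷ S))))) ⟩
  (a₀ + b₀) + (a₁ + b₁)
    ≡⟨ regroup a₀ b₀ a₁ b₁ ⟩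
  a₁ + (a₀ + (b₀ + b₁))
    ≡⟨ cong (λ t → a₁ + (a₀ + t)) (sym (trans (∑-++ (map _ Q) (map _ Q) _) (cong₂ _+_ (∑-map _ Q _) (∑-map _ Q _)))) ⟩
  a₁ + ∑ (properPatterns (suc n)) (λ (m , _ , S) → ∑ (rowsOf h m) (f ∘ fill S)) ∎
  where
  open ≡-Reasoning
  X = upTo (suc h)
  Q = properPatterns n
  g₁ g₂ : ℕ → ℤ
  g₁ x = ∑ (rowsOf h n) (f ∘ (suc x ∷_) ∘ map suc)
  g₂ x = ∑ Q (λ (m , _ , S) → ∑ (rowsOf h m) (f ∘ (suc x ∷_) ∘ fill S))
  a₀ = ∑ (rowsOf h n) (f ∘ (0 ∷_) ∘ map suc)
  b₀ = ∑ Q (λ (m , _ , S) → ∑ (rowsOf h m) (f ∘ (0 ∷_) ∘ fill S))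
  a₁ = ∑ (rowsOf h (suc n)) (f ∘ map suc)
  b₁ = ∑ Q (λ (m , _ , S) → ∑ (rowsOf h (suc m)) (f ∘ fill (+∷ S)))
  regroup : ∀ a b c d → (a + b) + (c + d) ≡ c + (a + (b + d))
  regroup = solve-∀

+-left-comm : ∀ a b c → a ℕ.+ (b ℕ.+ c) ≡ b ℕ.+ (a ℕ.+ c)
+-left-comm = ℕ-RingSolver.solve-∀

sum-map-suc : ∀ v → sum (map suc v) ≡ length v ℕ.+ sum v
sum-map-suc []      = refl
sum-map-suc (x ∷ v) = cong suc (trans (cong (x ℕ.+_) (sum-map-suc v)) (+-left-comm x (length v) (sum v)))

sum-fill : ∀ {n m} (S : Pattern n m) v → length v ≡ m → sum (fill S v) ≡ m ℕ.+ sum v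
sum-fill positive v refl = sum-map-suc v
sum-fill (0∷ S)   v p    = sum-fill S v p
sum-fill (+∷ S)   (x ∷ v) refl = cong suc (trans (cong (x ℕ.+_) (sum-fill S v refl)) (+-left-comm x (length v) (sum v)))

StrictlyMonotone : (ℕ → ℕ) → Set
StrictlyMonotone f = ∀ {x y} → x ℕ.< y → f x ℕ.< f y

OrderInvariant : (List ℕ → Bool) → Set
OrderInvariant P = ∀ f → StrictlyMonotone f → ∀ v → P (map f v) ≡ P v

fix0 : (ℕ → ℕ) → ℕ → ℕ
fix0 f zero    = 0
fix0 f (suc n) = suc (f n)

fix0-strict : ∀ {f} → StrictlyMonotone f → StrictlyMonotone (fix0 f)
fix0-strict {f} f< {zero}  {suc y} _       = s≤s z≤n
fix0-strict {f} f< {suc x} {suc y} (s≤s l) = s≤s (f< l)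

fill-map : ∀ {n m} (S : Pattern n m) (f : ℕ → ℕ) v → fill S (map f v) ≡ map (fix0 f) (fill S v)
fill-map positive f []      = refl
fill-map (positive {n}) f (x ∷ v) = cong (suc (f x) ∷_) (fill-map (positive {n}) f v)
fill-map (0∷ S)   f v       = cong (0 ∷_) (fill-map S f v)
fill-map (+∷ S)   f []      = refl
fill-map (+∷ S)   f (x ∷ v) = cong (suc (f x) ∷_) (fill-map S f v)

-- A map `f` of the letters of `v` acts on the filled word as `fix0 f`: zeros stay, and the raised
-- letters follow `f`. This map is again strictly monotone.
fill-invariant : ∀ {n m P} (S : Pattern n m) → OrderInvariant P → OrderInvariant (P ∘ fill S)
fill-invariant {P = P} S inv f f< v = trans (cong P (fill-map S f v)) (inv (fix0 f) (fix0-strict {f} f<) (fill S v))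

-- Rationality of the generating series of words

𝟏 : Bool → ℤ
𝟏 b = if b then 1ℤ else 0ℤ

act-∑ : ∀ D {A : Set} (xs : List A) (F : A → Series) →
  act D (λ e h → ∑ xs (λ x → F x e h)) ≐ (λ e h → ∑ xs (λ x → act D (F x) e h))
act-∑ D []       F e h = zero-act D e h
  where
  zero-act : ∀ D → act D (λ _ _ → 0ℤ) ≐ (λ _ _ → 0ℤ)
  zero-act (term c i j) e h = *-zeroʳ c
  zero-act (P ⊕ Q) e h = cong₂ _+_ (zero-act P e h) (zero-act Q e h)
  zero-act (P ⊗ Q) e h = trans (act-cong P (zero-act Q) e h) (zero-act P e h)
act-∑ D (x ∷ xs) F e h = trans (act-∔ D (F x) _ e h) (cong (_+_ (act D (F x) e h)) (act-∑ D xs F e h))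

Bdd-∑ : ∀ {α β} {A : Set} (xs : List A) {F : A → Series} → (∀ x → Bdd α β (F x)) →
  Bdd α β (λ e h → ∑ xs (λ x → F x e h))
Bdd-∑ []       b = bdd 0ℤ λ e h l → refl
Bdd-∑ (x ∷ xs) b = Bdd-∔ (b x) (Bdd-∑ xs b)

point : Bool → ℤ → Series
point b e₀ e (+ 0)    = 𝟏 (b ∧ ⌊ e₀ ≟ e ⌋)
point b e₀ e +[1+ n ] = 0ℤ
point b e₀ e -[1+ n ] = 0ℤ

Bdd-point : ∀ {α β} b e₀ → Bdd α β (point b e₀)
Bdd-point {α} {β} b e₀ = bdd (α * e₀) vanish
  where
  eq : ∀ α β e → α * e + β * 0ℤ ≡ α * e
  eq = solve-∀
  vanish : ∀ e h → α * e₀ <ℤ α * e + β * h → point b e₀ e h ≡ 0ℤ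
  vanish e +[1+ n ] l = refl
  vanish e -[1+ n ] l = refl
  vanish e (+ 0) l with e₀ ≟ e
  ... | no _     = cong 𝟏 (∧-zeroʳ b)
  ... | yes refl = contradiction (subst (α * e₀ <ℤ_) (eq α β e₀) l) (<-irrefl refl)

≟-shift : ∀ {a b c d} → a - b ≡ c - d → ⌊ a ≟ b ⌋ ≡ ⌊ c ≟ d ⌋
≟-shift {a} {b} {c} {d} p with a ≟ b | c ≟ d
... | yes _ | yes _ = refl
... | no _  | no _  = refl
... | yes q | no r  = contradiction (i-j≡0⇒i≡j c d (trans (sym p) (i≡j⇒i-j≡0 q))) r
... | no q  | yes r = contradiction (i-j≡0⇒i≡j a b (trans p (i≡j⇒i-j≡0 r))) q

-- G P n enumerates the words of length n over {0,…,h} satisfying P by 2 Σ v - w h; for n = w and P the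
-- tableau condition it is the generating series of the Schur polynomials.
module WordSeries (w : ℕ) where

  weightTest : (List ℕ → Bool) → ℤ → ℕ → List ℕ → ℤ
  weightTest P e h v = 𝟏 (P v ∧ ⌊ + (2 ℕ.* sum v) - + (w ℕ.* h) ≟ e ⌋)

  G : (List ℕ → Bool) → ℕ → Series
  G P n e (+ h)    = ∑ (rowsOf h n) (weightTest P e h)
  G P n e -[1+ h ] = 0ℤ

  -- The change of `2 Σ v - w h` when `h` grows by one and `m` letters are raised by one. The
  -- normalisation keeps `w` even for words shorter than `w`, so one family of factors serves the
  -- whole recursion.
  shift : ℕ → ℤ
  shift m = + (2 ℕ.* m) - + w

  factor : ℕ → Op
  factor m = bin (shift m) 1ℤ

  initial : (List ℕ → Bool) → ℕ → Series
  initial P n e h = ∑ (rowsOf 0 n) (λ v → point (P v) (+ (2 ℕ.* sum v) - + (w ℕ.* 0)) e h)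

  weightTest-shift : ∀ P Q m e h v v′ → P v ≡ Q v′ → sum v ≡ m ℕ.+ sum v′ →
    weightTest P e (suc h) v ≡ weightTest Q (e - shift m) h v′
  weightTest-shift P Q m e h v v′ p s = cong 𝟏 (cong₂ _∧_ p (≟-shift (trans (cong₂ (λ x y → x - y - e) lhs₁ lhs₂)
    (trans (arith (+ sum v′) (+ m) (+ w) (+ (w ℕ.* h)) e)
      (cong₂ (λ x y → x - + (w ℕ.* h) - (e - (y - + w))) (sym (pos-* 2 (sum v′))) (sym (pos-* 2 m)))))))
    where
    lhs₁ : + (2 ℕ.* sum v) ≡ + 2 * (+ m + + sum v′)
    lhs₁ = trans (cong (λ t → + (2 ℕ.* t)) s) (pos-* 2 (m ℕ.+ sum v′))
    lhs₂ : + (w ℕ.* suc h) ≡ + w + + (w ℕ.* h)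
    lhs₂ = cong +_ (ℕ.*-suc w h)
    arith : ∀ x m w y e → + 2 * (m + x) - (w + y) - e ≡ + 2 * x - y - (e - (+ 2 * m - w))
    arith = solve-∀

  -- Delete the zeros of a word and lower its other letters by one; P survives as P ∘ fill S.
  G-recursion : ∀ P n → OrderInvariant P →
    act (factor n) (G P n) ≐ initial P n ∔
      (λ e h → ∑ (properPatterns n) (λ (m , _ , S) → act (term 1ℤ (shift m) 1ℤ) (G (P ∘ fill S) m) e h))
  G-recursion P n inv e -[1+ h ] =
    sym (cong₂ _+_ (∑-zero (rowsOf 0 n)) (∑-zero (properPatterns n)))
  -- At `h = 0` all shifted terms are read at `z`-exponent -1 and vanish, leaving the words in the
  -- single letter 0.
  G-recursion P n inv e (+ 0) = cong₂ _+_
    (trans (*-identityˡ (G P n (e - 0ℤ) (+ 0))) (cong (λ t → G P n t (+ 0)) (+-identityʳ e)))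
    (sym (∑-zero (properPatterns n)))
  G-recursion P n inv e +[1+ h ] =
    trans (cong₂ (λ x y → 1ℤ * G P n x y + -1ℤ * G P n (e - shift n) (+ h)) (+-identityʳ e) (+-identityʳ +[1+ h ]))
    (trans (cong (λ t → 1ℤ * t + -1ℤ * G P n (e - shift n) (+ h)) recur)
    (trans (arith (G P n (e - shift n) (+ h)) R)
      (cong (_+ R) (sym (∑-zero (rowsOf 0 n))))))
    where
    R = ∑ (properPatterns n) (λ (m , _ , S) → act (term 1ℤ (shift m) 1ℤ) (G (P ∘ fill S) m) e +[1+ h ])
    arith : ∀ a r → 1ℤ * (a + r) + -1ℤ * a ≡ 0ℤ + r
    arith = solve-∀
    recur : G P n e +[1+ h ] ≡ G P n (e - shift n) (+ h) + R
    recur = trans (∑-rowsOf-split h n (weightTest P e (suc h)))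
      (cong₂ _+_
        (∑-rowsOf-cong h n (λ v p → weightTest-shift P P n e h (map suc v) v (inv suc s≤s v)
                                       (trans (sum-map-suc v) (cong (ℕ._+ sum v) p))))
        (∑-cong (properPatterns n) λ (m , _ , S) → trans
          (∑-rowsOf-cong h m (λ v p → weightTest-shift P (P ∘ fill S) m e h (fill S v) v refl (sum-fill S v p)))
          (sym (*-identityˡ _))))

  -- Induction on the number of factors, for all `P` at once. For words of length `n`, `factor n`
  -- leaves `initial` and the series of shorter words under `P ∘ fill S`, which the remaining
  -- factors clear; for shorter words `factor n` is merely an extra multiplier.
  G-rational : ∀ n m → m ℕ.< n → ∀ P → OrderInvariant P → ∀ α β → Bdd α β (act (∏ n factor) (G P m))
  G-rational (suc n) m m<1+n P inv α β with ℕ.m≤n⇒m<n∨m≡n (ℕ.s≤s⁻¹ m<1+n)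
  ... | inj₁ m<n  = Bdd-cong (act-comm (factor n) (∏ n factor) (G P m))
                      (Bdd-act (factor n) (G-rational n m m<n P inv α β))
  ... | inj₂ refl = Bdd-cong
    (λ e h → sym (trans (act-cong D (G-recursion P n inv) e h)
             (trans (act-∔ D (initial P n) (λ e h → ∑ (properPatterns n) (λ S → remainder S e h)) e h)
                    (cong (_+_ (act D (initial P n) e h)) (act-∑ D (properPatterns n) remainder e h)))))
    (Bdd-∔ (Bdd-act D (Bdd-∑ (rowsOf 0 n) (λ v → Bdd-point (P v) (+ (2 ℕ.* sum v) - + (w ℕ.* 0)))))
           (Bdd-∑ (properPatterns n) λ (m , m<n , S) →
             Bdd-cong (act-comm (term 1ℤ (shift m) 1ℤ) D (G (P ∘ fill S) m))
               (Bdd-act (term 1ℤ (shift m) 1ℤ)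
                 (G-rational n m m<n (P ∘ fill S) (fill-invariant {P = P} S inv) α β))))
    where
    D = ∏ n factor
    remainder : ProperPattern n → Series
    remainder (m , _ , S) = act (term 1ℤ (shift m) 1ℤ) (G (P ∘ fill S) m)

  G-below : ∀ P n → Bdd 0ℤ -1ℤ (G P n)
  G-below P n = bdd 0ℤ λ
    { e -[1+ h ] l → refl
    ; e (+ h)    l → contradiction
        (<-≤-trans l (subst (_≤ 0ℤ) (eq e (+ h)) (neg-mono-≤ (+≤+ z≤n)))) (<-irrefl refl) }
    where
    eq : ∀ e h → - h ≡ 0ℤ * e + -1ℤ * h
    eq = solve-∀

-- Semistandard tableaux

unflatten : List ℕ → List ℕ → List (List ℕ)
unflatten []      v = []
unflatten (l ∷ μ) v = take l v ∷ unflatten μ (drop l v)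

unflatten-++ : ∀ l μ r v → length r ≡ l → unflatten (l ∷ μ) (r ++ v) ≡ r ∷ unflatten μ v
unflatten-++ l μ r v refl = cong₂ _∷_ (take-length r) (cong (unflatten μ) (drop-length r))
  where
  take-length : ∀ r → take (length r) (r ++ v) ≡ r
  take-length []      = refl
  take-length (x ∷ r) = cong (x ∷_) (take-length r)
  drop-length : ∀ r → drop (length r) (r ++ v) ≡ v
  drop-length []      = refl
  drop-length (x ∷ r) = drop-length r

unflatten-map : ∀ μ (f : ℕ → ℕ) v → unflatten μ (map f v) ≡ map (map f) (unflatten μ v)
unflatten-map []      f v = refl
unflatten-map (l ∷ μ) f v = cong₂ _∷_ (take-map l v)
  (trans (cong (unflatten μ) (drop-map l v)) (unflatten-map μ f (drop l v)))

∑-rowsOf-++ : ∀ h l m (f : List ℕ → ℤ) →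
  ∑ (rowsOf h (l ℕ.+ m)) f ≡ ∑ (rowsOf h l) (λ r → ∑ (rowsOf h m) (λ v → f (r ++ v)))
∑-rowsOf-++ h zero    m f = sym (+-identityʳ _)
∑-rowsOf-++ h (suc l) m f = trans (∑-rowsOf-suc h (l ℕ.+ m) f)
  (trans (∑-cong (upTo (suc h)) (λ x → ∑-rowsOf-++ h l m (f ∘ (x ∷_))))
         (sym (∑-rowsOf-suc h l (λ r → ∑ (rowsOf h m) (λ v → f (r ++ v))))))

∑-fillings : ∀ h μ (f : List (List ℕ) → ℤ) → ∑ (fillings h μ) f ≡ ∑ (rowsOf h (sum μ)) (f ∘ unflatten μ)
∑-fillings h []      f = refl
∑-fillings h (l ∷ μ) f = begin
  ∑ (fillings h (l ∷ μ)) f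
    ≡⟨ ∑-concatMap (λ r → map (r ∷_) (fillings h μ)) (rowsOf h l) f ⟩
  ∑ (rowsOf h l) (λ r → ∑ (map (r ∷_) (fillings h μ)) f)
    ≡⟨ ∑-rowsOf-cong h l (λ r p → trans (∑-map (r ∷_) (fillings h μ) f) (trans (∑-fillings h μ (f ∘ (r ∷_)))
         (∑-cong (rowsOf h (sum μ)) (λ v → cong f (sym (unflatten-++ l μ r v p)))))) ⟩
  ∑ (rowsOf h l) (λ r → ∑ (rowsOf h (sum μ)) (λ v → f (unflatten (l ∷ μ) (r ++ v))))
    ≡⟨ sym (∑-rowsOf-++ h l (sum μ) (f ∘ unflatten (l ∷ μ))) ⟩
  ∑ (rowsOf h (l ℕ.+ sum μ)) (f ∘ unflatten (l ∷ μ)) ∎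
  where open ≡-Reasoning

rowWeight : ∀ h r → foldr _+_ 0ℤ (map (λ t → + (2 ℕ.* t) - + h) r) ≡ + (2 ℕ.* sum r) - + (length r ℕ.* h)
rowWeight h []      = refl
rowWeight h (x ∷ r) = begin
  + (2 ℕ.* x) - + h + foldr _+_ 0ℤ (map (λ t → + (2 ℕ.* t) - + h) r)
    ≡⟨ cong (_+_ (+ (2 ℕ.* x) - + h)) (rowWeight h r) ⟩
  + (2 ℕ.* x) - + h + (+ (2 ℕ.* sum r) - + (length r ℕ.* h))
    ≡⟨ sym (minus-interchange (+ (2 ℕ.* x)) (+ (2 ℕ.* sum r)) (+ h) (+ (length r ℕ.* h))) ⟩
  + (2 ℕ.* x) + + (2 ℕ.* sum r) - (+ h + + (length r ℕ.* h))
    ≡⟨ cong (λ t → + t - (+ h + + (length r ℕ.* h))) (sym (ℕ.*-distribˡ-+ 2 x (sum r))) ⟩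
  + (2 ℕ.* sum (x ∷ r)) - + (length (x ∷ r) ℕ.* h) ∎
  where
  open ≡-Reasoning

qWeight-unflatten : ∀ h μ v → length v ≡ sum μ → qWeight h (unflatten μ v) ≡ + (2 ℕ.* sum v) - + (sum μ ℕ.* h)
qWeight-unflatten h []      [] p = refl
qWeight-unflatten h (l ∷ μ) v  p = begin
  foldr _+_ 0ℤ (map (λ t → + (2 ℕ.* t) - + h) (take l v)) + qWeight h (unflatten μ (drop l v))
    ≡⟨ cong₂ _+_ (rowWeight h (take l v)) (qWeight-unflatten h μ (drop l v) lenDrop) ⟩
  + (2 ℕ.* a) - + (length (take l v) ℕ.* h) + (+ (2 ℕ.* b) - + (sum μ ℕ.* h))
    ≡⟨ cong (λ t → + (2 ℕ.* a) - + (t ℕ.* h) + (+ (2 ℕ.* b) - + (sum μ ℕ.* h))) lenTake ⟩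
  + (2 ℕ.* a) - + (l ℕ.* h) + (+ (2 ℕ.* b) - + (sum μ ℕ.* h))
    ≡⟨ sym (minus-interchange (+ (2 ℕ.* a)) (+ (2 ℕ.* b)) (+ (l ℕ.* h)) (+ (sum μ ℕ.* h))) ⟩
  + (2 ℕ.* a ℕ.+ 2 ℕ.* b) - + (l ℕ.* h ℕ.+ sum μ ℕ.* h)
    ≡⟨ cong₂ (λ s t → + s - + t) (trans (sym (ℕ.*-distribˡ-+ 2 a b)) (cong (2 ℕ.*_) total))
         (sym (ℕ.*-distribʳ-+ h l (sum μ))) ⟩
  + (2 ℕ.* sum v) - + ((l ℕ.+ sum μ) ℕ.* h) ∎
  where
  open ≡-Reasoning
  a = sum (take l v)
  b = sum (drop l v)
  lenDrop : length (drop l v) ≡ sum μ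
  lenDrop = trans (length-drop l v) (trans (cong (ℕ._∸ l) p) (ℕ.m+n∸m≡n l (sum μ)))
  lenTake : length (take l v) ≡ l
  lenTake = trans (length-take l v) (trans (cong (l ℕ.⊓_) p) (ℕ.m≤n⇒m⊓n≡m (ℕ.m≤m+n l (sum μ))))
  total : a ℕ.+ b ≡ sum v
  total = trans (sym (sum-++ (take l v) (drop l v))) (cong sum (take++drop≡id l v))

count-∑ : {A : Set} (p : A → Bool) (xs : List A) → + count p xs ≡ ∑ xs (𝟏 ∘ p)
count-∑ p []       = refl
count-∑ p (x ∷ xs) with p x
... | true  = cong (_+_ 1ℤ) (count-∑ p xs)
... | false = trans (count-∑ p xs) (sym (+-identityˡ _))

reflects-map : ∀ {A B : Set} {b} → (A → B) → (B → A) → Reflects A b → Reflects B b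
reflects-map f g (ofʸ a)  = ofʸ (f a)
reflects-map f g (ofⁿ ¬a) = ofⁿ (¬a ∘ g)

module _ (f : ℕ → ℕ) (f< : StrictlyMonotone f) where

  reflects-< : ∀ {x y} → f x ℕ.< f y → x ℕ.< y
  f-≤ : ∀ {x y} → x ℕ.≤ y → f x ℕ.≤ f y
  f-≤ l with ℕ.m≤n⇒m<n∨m≡n l
  ... | inj₁ x<y  = ℕ.<⇒≤ (f< x<y)
  ... | inj₂ refl = ℕ.≤-refl
  reflects-< {x} {y} l with x ℕ.<? y
  ... | yes x<y = x<y
  ... | no  x≮y = contradiction (ℕ.<-≤-trans l (f-≤ (ℕ.≮⇒≥ x≮y))) (ℕ.<-irrefl refl)

  <ᵇ-map : ∀ x y → (f x <ᵇ f y) ≡ (x <ᵇ y)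
  <ᵇ-map x y = det (reflects-map reflects-< f< (ℕ.<ᵇ-reflects-< (f x) (f y))) (ℕ.<ᵇ-reflects-< x y)

  ≤ᵇ-map : ∀ x y → (f x ≤ᵇ f y) ≡ (x ≤ᵇ y)
  ≤ᵇ-map x y = det (reflects-map (λ l → ℕ.≮⇒≥ λ y<x → ℕ.<-irrefl refl (ℕ.<-≤-trans (f< y<x) l)) f-≤
                     (ℕ.≤ᵇ-reflects-≤ (f x) (f y))) (ℕ.≤ᵇ-reflects-≤ x y)

  rowWeak-map : ∀ r → rowWeak (map f r) ≡ rowWeak r
  rowWeak-map []          = refl
  rowWeak-map (x ∷ [])    = refl
  rowWeak-map (x ∷ y ∷ r) = cong₂ _∧_ (≤ᵇ-map x y) (rowWeak-map (y ∷ r))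

  colStrict-map : ∀ r r′ → colStrict (map f r) (map f r′) ≡ colStrict r r′
  colStrict-map []      r′       = refl
  colStrict-map (x ∷ r) []       = refl
  colStrict-map (x ∷ r) (y ∷ r′) = cong₂ _∧_ (<ᵇ-map x y) (colStrict-map r r′)

  isSSYT-map : ∀ T → isSSYT (map (map f) T) ≡ isSSYT T
  isSSYT-map []           = refl
  isSSYT-map (r ∷ [])     = rowWeak-map r
  isSSYT-map (r ∷ r′ ∷ T) = cong₂ _∧_ (rowWeak-map r) (cong₂ _∧_ (colStrict-map r r′) (isSSYT-map (r′ ∷ T)))

isTableau : List ℕ → List ℕ → Bool
isTableau μ v = isSSYT (unflatten μ v)

-- Semistandardness compares letters only through `<` and `≤`, and a strictly monotone map of ℕ
-- preserves and reflects both.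
isTableau-invariant : ∀ μ → OrderInvariant (isTableau μ)
isTableau-invariant μ f f< v = trans (cong isSSYT (unflatten-map μ f v)) (isSSYT-map f f< (unflatten μ v))

schurCoeff-G : ∀ μ h e → schurCoeff μ h e ≡ WordSeries.G (sum μ) (isTableau μ) (sum μ) e (+ h)
schurCoeff-G μ h e = trans (count-∑ _ (fillings h μ)) (trans (∑-fillings h μ _)
  (∑-rowsOf-cong h (sum μ) λ v p → cong (λ t → 𝟏 (isTableau μ v ∧ ⌊ t ≟ e ⌋)) (qWeight-unflatten h μ v p)))

-- Expansion in q-integers and the positive part

telescope : ∀ n (t : ℕ → ℤ) → ∑ (upTo n) (λ j → t j - t (suc j)) ≡ t 0 - t n
telescope zero    t = sym (+-inverseʳ (t 0))
telescope (suc n) t = trans (∑-upTo-suc n (λ j → t j - t (suc j)))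
  (trans (cong (_+_ (t 0 - t 1)) (telescope n (t ∘ suc))) (arith (t 0) (t 1) (t (suc n))))
  where
  arith : ∀ a b c → a - b + (b - c) ≡ a - c
  arith = solve-∀

∑-minus : {A : Set} (xs : List A) (f g : A → ℤ) → ∑ xs f - ∑ xs g ≡ ∑ xs (λ x → f x - g x)
∑-minus []       f g = refl
∑-minus (x ∷ xs) f g = trans (minus-interchange (f x) (∑ xs f) (g x) (∑ xs g)) (cong (_+_ (f x - g x)) (∑-minus xs f g))

-- This is (q - q⁻¹) [k]_q = q^k - q^{-k}, compared in the positive degree i + 1.
qintCoeff-difference : ∀ k i → qintCoeff k (+ i) - qintCoeff k (+ (2 ℕ.+ i)) ≡ 𝟏 ⌊ + k ≟ +[1+ i ] ⌋
qintCoeff-difference k i = begin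
  qintCoeff k (+ i) - qintCoeff k (+ (2 ℕ.+ i))
    ≡⟨ cong₂ _-_ (count-∑ _ (upTo k)) (count-∑ _ (upTo k)) ⟩
  ∑ (upTo k) _ - ∑ (upTo k) _
    ≡⟨ ∑-minus (upTo k) _ _ ⟩
  ∑ (upTo k) _
    -- Raising the exponent by 2 amounts to replacing `j` by `j + 1`, so the difference telescopes.
    ≡⟨ ∑-cong (upTo k) (λ j → cong₂ (λ x y → 𝟏 x - 𝟏 y)
         (≟-shift { + k - 1ℤ - + (2 ℕ.* j)} { + i} { + k - + (2 ℕ.* j)} { +[1+ i ]} (arith₁ (+ k) (+ (2 ℕ.* j)) (+ i)))
         (≟-shift { + k - 1ℤ - + (2 ℕ.* j)} { + (2 ℕ.+ i)} { + k - + (2 ℕ.* suc j)} { +[1+ i ]}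
           (trans (arith₂ (+ k) (+ (2 ℕ.* j)) (+ i)) (cong (λ x → + k - + x - +[1+ i ]) (sym (ℕ.*-suc 2 j)))))) ⟩
  ∑ (upTo k) (λ j → t j - t (suc j))
    ≡⟨ telescope k t ⟩
  t 0 - t k
    ≡⟨ cong₂ _-_ (cong (λ x → 𝟏 ⌊ x ≟ +[1+ i ] ⌋) (+-identityʳ (+ k))) last ⟩
  𝟏 ⌊ + k ≟ +[1+ i ] ⌋ - 0ℤ
    ≡⟨ +-identityʳ _ ⟩
  𝟏 ⌊ + k ≟ +[1+ i ] ⌋ ∎
  where
  open ≡-Reasoning
  t : ℕ → ℤ
  t j = 𝟏 ⌊ + k - + (2 ℕ.* j) ≟ +[1+ i ] ⌋
  arith₁ : ∀ k j i → k - 1ℤ - j - i ≡ k - j - (1ℤ + i)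
  arith₁ = solve-∀
  arith₂ : ∀ k j i → k - 1ℤ - j - (+ 2 + i) ≡ k - (+ 2 + j) - (1ℤ + i)
  arith₂ = solve-∀
  double : ∀ k → k - + 2 * k ≡ - k
  double = solve-∀
  -- The final exponent is k - 2k = -k, never positive.
  last : t k ≡ 0ℤ
  last with + k - + (2 ℕ.* k) ≟ +[1+ i ]
  ... | no _  = refl
  ... | yes p = contradiction
    (subst (_≤ 0ℤ) (trans (sym (trans (cong (λ x → + k - x) (pos-* 2 k)) (double (+ k)))) p) (neg-mono-≤ (+≤+ (z≤n {k}))))
    λ { (+≤+ ()) }

sumFrom1-minus : ∀ K (f g : ℕ → ℤ) → sumFrom1 K f - sumFrom1 K g ≡ sumFrom1 K (λ k → f k - g k)
sumFrom1-minus zero    f g = refl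
sumFrom1-minus (suc K) f g = trans (minus-interchange (sumFrom1 K f) (f (suc K)) (sumFrom1 K g) (g (suc K)))
  (cong (_+ (f (suc K) - g (suc K))) (sumFrom1-minus K f g))

sumFrom1-cong : ∀ K {f g : ℕ → ℤ} → (∀ k → f k ≡ g k) → sumFrom1 K f ≡ sumFrom1 K g
sumFrom1-cong zero    p = refl
sumFrom1-cong (suc K) p = cong₂ _+_ (sumFrom1-cong K p) (p (suc K))

sumFrom1-delta : ∀ K (b : ℕ → ℤ) i → (∀ k → K ℕ.< k → b k ≡ 0ℤ) →
  sumFrom1 K (λ k → b k * 𝟏 ⌊ + k ≟ +[1+ i ] ⌋) ≡ b (suc i)
sumFrom1-delta K b i vanish = by-cases
  where
  small : ∀ K → K ℕ.≤ i → sumFrom1 K (λ k → b k * 𝟏 ⌊ + k ≟ +[1+ i ] ⌋) ≡ 0ℤ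
  small zero    _   = refl
  small (suc K) K<i with + suc K ≟ +[1+ i ]
  ... | yes refl = contradiction K<i (ℕ.<-irrefl refl)
  ... | no _     = cong₂ _+_ (small K (ℕ.<⇒≤ K<i)) (*-zeroʳ (b (suc K)))
  large : ∀ K → i ℕ.< K → sumFrom1 K (λ k → b k * 𝟏 ⌊ + k ≟ +[1+ i ] ⌋) ≡ b (suc i)
  large (suc K) i<1+K with + suc K ≟ +[1+ i ]
  ... | yes refl = trans (cong₂ _+_ (small K ℕ.≤-refl) (*-identityʳ (b (suc K)))) (+-identityˡ _)
  ... | no K≢i   = trans (cong₂ _+_ (large K (ℕ.≤∧≢⇒< (ℕ.s≤s⁻¹ i<1+K) λ { refl → K≢i refl }))
                                     (*-zeroʳ (b (suc K)))) (+-identityʳ _)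
  by-cases : _
  by-cases with i ℕ.<? K
  ... | yes i<K = large K i<K
  ... | no  i≮K = trans (small K (ℕ.≮⇒≥ i≮K)) (sym (vanish (suc i) (s≤s (ℕ.≮⇒≥ i≮K))))

-- As with multiplicities of irreducible sl₂-characters, neighbouring weight multiplicities are
-- subtracted: only the term with `k = i + 1` survives.
expansion-coefficient : ∀ μ a → IsQIntExpansion μ a → ∀ i h →
  a (suc i) h ≡ schurCoeff μ h (+ i) - schurCoeff μ h (+ (2 ℕ.+ i))
expansion-coefficient μ a exp i h with exp h
... | K , vanish , eq = sym (trans (cong₂ _-_ (eq (+ i)) (eq (+ (2 ℕ.+ i))))
  (trans (sumFrom1-minus K _ _)
  (trans (sumFrom1-cong K (λ k → trans (sym (*-distribˡ-minus (a k h) _ _)) (cong (a k h *_) (qintCoeff-difference k i))))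
         (sumFrom1-delta K (λ k → a k h) i vanish))))
  where
  *-distribˡ-minus : ∀ x y z → x * (y - z) ≡ x * y - x * z
  *-distribˡ-minus = solve-∀

extend : (ℕ → ℕ → ℤ) → Series
extend F (+ k)    (+ h)    = F k h
extend F (+ k)    -[1+ h ] = 0ℤ
extend F -[1+ k ] h        = 0ℤ

q-q⁻¹ : Op
q-q⁻¹ = term 1ℤ 1ℤ 0ℤ ⊕ term -1ℤ -1ℤ 0ℤ

extend-Acoeff : ∀ μ a → IsQIntExpansion μ a →
  extend (Acoeff a) ≐ π (act q-q⁻¹ (WordSeries.G (sum μ) (isTableau μ) (sum μ)))
extend-Acoeff μ a exp -[1+ k ] h        = refl
extend-Acoeff μ a exp (+ 0)    (+ h)    = refl
extend-Acoeff μ a exp (+ 0)    -[1+ h ] = refl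
extend-Acoeff μ a exp +[1+ k ] -[1+ h ] = refl
extend-Acoeff μ a exp +[1+ k ] (+ h)    = begin
  a (suc k) h
    ≡⟨ expansion-coefficient μ a exp k h ⟩
  schurCoeff μ h (+ k) - schurCoeff μ h (+ (2 ℕ.+ k))
    ≡⟨ cong₂ _-_ (schurCoeff-G μ h (+ k)) (schurCoeff-G μ h (+ (2 ℕ.+ k))) ⟩
  G (+ k) (+ h) - G (+ (2 ℕ.+ k)) (+ h)
    ≡⟨ cong₂ (λ x y → G x (+ h) - G y (+ h)) (arith₁ (+ k)) (arith₂ (+ k)) ⟩
  G (+[1+ k ] - 1ℤ) (+ h) - G (+[1+ k ] - -1ℤ) (+ h)
    ≡⟨ arith₃ (G (+[1+ k ] - 1ℤ) (+ h)) (G (+[1+ k ] - -1ℤ) (+ h)) ⟩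
  1ℤ * G (+[1+ k ] - 1ℤ) (+ h) + -1ℤ * G (+[1+ k ] - -1ℤ) (+ h)
    ≡⟨ cong (λ x → 1ℤ * G (+[1+ k ] - 1ℤ) x + -1ℤ * G (+[1+ k ] - -1ℤ) x) (sym (+-identityʳ (+ h))) ⟩
  act q-q⁻¹ G +[1+ k ] (+ h) ∎
  where
  open ≡-Reasoning
  G = WordSeries.G (sum μ) (isTableau μ) (sum μ)
  arith₁ : ∀ k → k ≡ 1ℤ + k - 1ℤ
  arith₁ = solve-∀
  arith₂ : ∀ k → + 2 + k ≡ 1ℤ + k - -1ℤ
  arith₂ = solve-∀
  arith₃ : ∀ x y → x - y ≡ 1ℤ * x + -1ℤ * y
  arith₃ = solve-∀

-- The denominators d_w

toOp : Poly → Op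
toOp []                = 𝟘
toOp ((c , i , j) ∷ P) = term c (+ i) (+ j) ⊕ toOp P

⊖-<-negative : ∀ {m n} → m ℕ.< n → m ⊖ n ≡ -[1+ (n ℕ.∸ suc m) ]
⊖-<-negative {m} {n} m<n = trans (⊖-< m<n) (cong (λ x → - + x) (ℕ.+-∸-assoc 1 m<n))

-- The two guards amount to extension by zero: where one fails, the true difference is negative and
-- `extend F` vanishes; otherwise truncated and true differences agree.
extend-minus : ∀ F c k h i j →
  (if (i ≤ᵇ k) ∧ (j ≤ᵇ h) then c * F (k ℕ.∸ i) (h ℕ.∸ j) else 0ℤ) ≡ c * extend F (+ k - + i) (+ h - + j)
extend-minus F c k h i j
  rewrite m-n≡m⊖n k i | m-n≡m⊖n h j
  with i ≤ᵇ k | ℕ.≤ᵇ-reflects-≤ i k | j ≤ᵇ h | ℕ.≤ᵇ-reflects-≤ j h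
... | false | ofⁿ i≰k | _     | _       rewrite ⊖-<-negative (ℕ.≰⇒> i≰k) = sym (*-zeroʳ c)
... | true  | ofʸ i≤k | false | ofⁿ j≰h rewrite ⊖-≥ i≤k | ⊖-<-negative (ℕ.≰⇒> j≰h) = sym (*-zeroʳ c)
... | true  | ofʸ i≤k | true  | ofʸ j≤h rewrite ⊖-≥ i≤k | ⊖-≥ j≤h = refl

mulSeriesCoeff-act : ∀ P F k h → mulSeriesCoeff P F k h ≡ act (toOp P) (extend F) (+ k) (+ h)
mulSeriesCoeff-act []                F k h = refl
mulSeriesCoeff-act ((c , i , j) ∷ P) F k h = cong₂ _+_ (extend-minus F c k h i j) (mulSeriesCoeff-act P F k h)

toOp-++ : ∀ P Q → toOp (P ++ Q) ≋ toOp P ⊕ toOp Q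
toOp-++ []      Q = O.sym (O.+-identityˡ (toOp Q))
toOp-++ (t ∷ P) Q = O.trans (O.+-congˡ (toOp-++ P Q)) (O.sym (O.+-assoc _ (toOp P) (toOp Q)))

term-⊗ : ∀ c i j d k l → term (c * d) (i + k) (j + l) ≋ term c i j ⊗ term d k l
term-⊗ c i j d k l = mk λ F e h →
  trans (*-assoc c d _) (cong₂ (λ x y → c * (d * F x y)) (minus-+ e i k) (minus-+ h j l))

toOp-map : ∀ c i j (g : ℤ × ℕ × ℕ → ℤ × ℕ × ℕ) →
  (∀ d k l → g (d , k , l) ≡ (c * d , i ℕ.+ k , j ℕ.+ l)) →
  ∀ Q → toOp (map g Q) ≋ term c (+ i) (+ j) ⊗ toOp Q
toOp-map c i j g p []                = O.sym (O.zeroʳ (term c (+ i) (+ j)))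
toOp-map c i j g p ((d , k , l) ∷ Q) rewrite p d k l =
  O.trans (O.+-cong (term-⊗ c (+ i) (+ j) d (+ k) (+ l)) (toOp-map c i j g p Q))
          (O.sym (O.distribˡ (term c (+ i) (+ j)) (term d (+ k) (+ l)) (toOp Q)))

toOp-· : ∀ P Q → toOp (P · Q) ≋ toOp P ⊗ toOp Q
toOp-· []                Q = O.sym (O.zeroˡ (toOp Q))
toOp-· ((c , i , j) ∷ P) Q =
  O.trans (toOp-++ (map _ Q) (P · Q))
  (O.trans (O.+-cong (toOp-map c i j _ (λ d k l → refl) Q) (toOp-· P Q))
           (O.sym (O.distribʳ (toOp Q) (term c (+ i) (+ j)) (toOp P))))

toOp-binom : ∀ i j → toOp (binom i j) ≋ bin (+ i) (+ j)
toOp-binom i j = O.+-congˡ {𝟙} (O.+-identityʳ (term -1ℤ (+ i) (+ j)))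

toOp-prodFrom1 : ∀ n f g → (∀ i → toOp (f (suc i)) ≋ g i) → toOp (prodFrom1 n f) ≋ ∏ n g
toOp-prodFrom1 zero    f g p = O.+-identityʳ 𝟙
toOp-prodFrom1 (suc n) f g p = O.trans (toOp-· (prodFrom1 n f) (f (suc n)))
  (O.*-cong (toOp-prodFrom1 n f g p) (p n))

∏-cong : ∀ n {f g : ℕ → Op} → (∀ i → f i ≡ g i) → ∏ n f ≋ ∏ n g
∏-cong zero    p = O.refl
∏-cong (suc n) p = O.*-cong (∏-cong n p) (O.reflexive (p n))

∏-+ : ∀ m n f → ∏ (m ℕ.+ n) f ≋ ∏ m f ⊗ ∏ n (λ i → f (m ℕ.+ i))
∏-+ m zero    f rewrite ℕ.+-identityʳ m = O.sym (O.*-identityʳ (∏ m f))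
∏-+ m (suc n) f rewrite ℕ.+-suc m n = O.trans (O.*-congʳ {f (m ℕ.+ n)} (∏-+ m n f))
  (O.*-assoc (∏ m f) (∏ n (λ i → f (m ℕ.+ i))) (f (m ℕ.+ n)))

∏-head : ∀ n f → ∏ (suc n) f ≋ f 0 ⊗ ∏ n (f ∘ suc)
∏-head n f = O.trans (∏-+ 1 n f) (O.*-congʳ {∏ n (f ∘ suc)} (O.*-identityˡ (f 0)))

-- The condition `i + suc j ≡ n` encodes j = n - 1 - i without truncated subtraction. It lets the
-- factors of negative exponent, met from the lowest up, be indexed by increasing absolute value.
∏-reverse : ∀ n (f g : ℕ → Op) → (∀ i j → i ℕ.+ suc j ≡ n → f i ≡ g j) → ∏ n f ≋ ∏ n g
∏-reverse zero    f g p = O.refl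
∏-reverse (suc n) f g p = O.trans (∏-head n f)
  (O.trans (O.*-cong (O.reflexive (p 0 n refl)) (∏-reverse n (f ∘ suc) g (λ i j q → p (suc i) j (cong suc q))))
           (O.*-comm (g n) (∏ n g)))

-- Joins the rationality of `G` to the positive-part argument. The exponents of `D₋` are the
-- negatives of those of `D₊` because m ↦ w - m negates 2m - w.
module Parity
  (w k : ℕ) (p : ℕ → ℕ) (p>0 : ∀ i → 0 ℕ.< p i)
  (D₀ C : Op) (pres : Preservesπ (D₀ ⊗ C))
  (C∈ : C ∈⟨ ∏ k (λ i → bin (+ p i) 1ℤ) , ∏ k (λ i → bin (- (+ p i)) 1ℤ) ⟩)
  (factorisation : ∏ (suc w) (WordSeries.factor w) ≋
    ∏ k (λ i → bin (+ p i) 1ℤ) ⊗ D₀ ⊗ ∏ k (λ i → bin (- (+ p i)) 1ℤ))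
  where

  open WordSeries w

  positivePart : ∀ P → OrderInvariant P →
    Bounded (act (∏ k (λ i → bin (+ p i) 1ℤ) ⊗ (D₀ ⊗ C)) (π (act q-q⁻¹ (G P w))))
  positivePart P inv = PositivePart.positivePart-bounded (λ i → + p i) (λ i → - (+ p i))
    (λ i → +≤+ (p>0 i)) (λ i → neg-mono-≤ (+≤+ (p>0 i))) k k D₀ C pres C∈
    (act q-q⁻¹ (G P w)) (Bdd-act q-q⁻¹ (G-below P w))
    (λ α β → Bdd-cong (λ e h → trans (act-comm q-q⁻¹ (∏ (suc w) factor) (G P w) e h)
                                     (ap factorisation (act q-q⁻¹ (G P w)) e h))
               (Bdd-act q-q⁻¹ (G-rational (suc w) w ℕ.≤-refl P inv α β)))

-- `d w` regrouped as `D₊ (D₀ C)` for w = 2n and w = 2n + 1. For odd w no exponent 2m - w is zero,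
-- hence `D₀ = 𝟙`.
evenDenominator oddDenominator : ℕ → Op
evenDenominator n = ∏ n (λ i → bin (+ (2 ℕ.* suc i)) 1ℤ) ⊗ (bin 0ℤ 1ℤ ⊗ ∏ (n ℕ.+ n) (λ s → bin 0ℤ (+ suc s)))
oddDenominator  n = ∏ (suc n) (λ i → bin (+ suc (2 ℕ.* i)) 1ℤ) ⊗ (𝟙 ⊗ ∏ (n ℕ.+ suc n) (λ s → bin 0ℤ (+ (2 ℕ.* suc s))))

even-bounded : ∀ n P → OrderInvariant P →
  Bounded (act (evenDenominator n) (π (act q-q⁻¹ (WordSeries.G (n ℕ.+ n) P (n ℕ.+ n)))))
even-bounded n = Parity.positivePart (n ℕ.+ n) n p (λ i → s≤s z≤n) (bin 0ℤ 1ℤ) (C n n)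
  (preserves-⊗ {bin 0ℤ 1ℤ} {C n n} (preserves-bin 1ℤ) (preserves-∏ (n ℕ.+ n) (λ s → preserves-bin (+ suc s))))
  (∏-comaximal (λ i → bin (+ p i) 1ℤ) (λ i → bin (- (+ p i)) 1ℤ) C step n n)
  factorisation
  where
  open WordSeries (n ℕ.+ n) using (factor; shift)
  p : ℕ → ℕ
  p i = 2 ℕ.* suc i
  f : ℕ → Op
  f s = bin 0ℤ (+ suc s)
  C : ℕ → ℕ → Op
  C i j = ∏ (i ℕ.+ j) f
  step : ∀ i j → ∃ λ c → c ∈⟨ bin (+ p i) 1ℤ , bin (- (+ p j)) 1ℤ ⟩ ×
           C (suc i) (suc j) ≋ c ⊗ C i (suc j) × C i (suc j) ≋ C (suc i) j
  -- The exponents are 2(i+1) and -2(j+1); taking out `s = 2` gives 1 - z^((i+1)+(j+1)) without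
  -- doubling the power of z. It depends on `i + j` alone, so `C` can be indexed by the sum.
  step i j = f (i ℕ.+ suc j) , bin-bezout (+ 2) (suc i) (suc j) , O.*-comm (C i (suc j)) (f (i ℕ.+ suc j)) ,
             O.reflexive (cong (λ s → ∏ s f) (ℕ.+-suc i j))
  shift-middle : shift (n ℕ.+ 0) ≡ 0ℤ
  shift-middle = i≡j⇒i-j≡0 (cong +_ (arith n))
    where
    arith : ∀ n → 2 ℕ.* (n ℕ.+ 0) ≡ n ℕ.+ n
    arith = ℕ-RingSolver.solve-∀
  shift-high : ∀ i → shift (n ℕ.+ suc i) ≡ + p i
  shift-high i = trans (cong (λ x → + x - + (n ℕ.+ n)) (arith n i)) (i+j-j≡i (+ p i) (+ (n ℕ.+ n)))
    where
    arith : ∀ n i → 2 ℕ.* (n ℕ.+ suc i) ≡ 2 ℕ.* suc i ℕ.+ (n ℕ.+ n)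
    arith = ℕ-RingSolver.solve-∀
  shift-low : ∀ i j → i ℕ.+ suc j ≡ n → shift i ≡ - (+ p j)
  shift-low i j refl = trans (cong (λ x → + (2 ℕ.* i) - + x) (arith i j)) (i-[i+j]≡-j (+ (2 ℕ.* i)) (+ p j))
    where
    arith : ∀ i j → (i ℕ.+ suc j) ℕ.+ (i ℕ.+ suc j) ≡ 2 ℕ.* i ℕ.+ 2 ℕ.* suc j
    arith = ℕ-RingSolver.solve-∀
  D₊ D₋ : Op
  D₊ = ∏ n (λ i → bin (+ p i) 1ℤ)
  D₋ = ∏ n (λ i → bin (- (+ p i)) 1ℤ)
  factorisation : ∏ (suc (n ℕ.+ n)) factor ≋ D₊ ⊗ bin 0ℤ 1ℤ ⊗ D₋
  factorisation =
    O.trans (O.reflexive (cong (λ s → ∏ s factor) (sym (ℕ.+-suc n n))))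
    (O.trans (∏-+ n (suc n) factor)
    (O.trans (O.*-cong
        (∏-reverse n factor (λ i → bin (- (+ p i)) 1ℤ) (λ i j q → cong (λ x → bin x 1ℤ) (shift-low i j q)))
        (O.trans (∏-head n (λ i → factor (n ℕ.+ i)))
          (O.*-cong (O.reflexive (cong (λ x → bin x 1ℤ) shift-middle))
                    (∏-cong n (λ i → cong (λ x → bin x 1ℤ) (shift-high i))))))
    (O.trans (O.*-comm D₋ (bin 0ℤ 1ℤ ⊗ D₊)) (O.*-congʳ {D₋} (O.*-comm (bin 0ℤ 1ℤ) D₊)))))

odd-bounded : ∀ n P → OrderInvariant P →
  Bounded (act (oddDenominator n) (π (act q-q⁻¹ (WordSeries.G (n ℕ.+ suc n) P (n ℕ.+ suc n)))))
odd-bounded n = Parity.positivePart (n ℕ.+ suc n) (suc n) p (λ i → s≤s z≤n) 𝟙 (C (suc n) (suc n))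
  (preserves-⊗ {𝟙} {C (suc n) (suc n)} preserves-𝟙 (preserves-∏ (n ℕ.+ suc n) (λ s → preserves-bin (+ (2 ℕ.* suc s)))))
  (∏-comaximal (λ i → bin (+ p i) 1ℤ) (λ i → bin (- (+ p i)) 1ℤ) C step (suc n) (suc n))
  factorisation
  where
  open WordSeries (n ℕ.+ suc n) using (factor; shift)
  p : ℕ → ℕ
  p i = suc (2 ℕ.* i)
  f : ℕ → Op
  f s = bin 0ℤ (+ (2 ℕ.* suc s))
  C : ℕ → ℕ → Op
  -- For positive `i` and `j`, the sums `p i′ + p j′` with `i′ < i` and `j′ < j` take the values 2,
  -- 4, ..., 2(i + j - 1), one factor for each.
  C i j = ∏ ((i ℕ.+ j) ℕ.∸ 1) f
  bezout : ∀ i j → f (i ℕ.+ j) ∈⟨ bin (+ p i) 1ℤ , bin (- (+ p j)) 1ℤ ⟩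
  bezout i j = subst₂ (λ P Q → f (i ℕ.+ j) ∈⟨ P , Q ⟩)
    (cong (λ x → bin x 1ℤ) (*-identityˡ (+ p i))) (cong (λ x → bin (- x) 1ℤ) (*-identityˡ (+ p j)))
    (subst (λ s → bin 0ℤ (+ s) ∈⟨ bin (1ℤ * + p i) 1ℤ , bin (- (1ℤ * + p j)) 1ℤ ⟩) (arith i j)
      (bin-bezout 1ℤ (p i) (p j)))
    where
    arith : ∀ i j → suc (2 ℕ.* i) ℕ.+ suc (2 ℕ.* j) ≡ 2 ℕ.* suc (i ℕ.+ j)
    arith = ℕ-RingSolver.solve-∀
  step : ∀ i j → ∃ λ c → c ∈⟨ bin (+ p i) 1ℤ , bin (- (+ p j)) 1ℤ ⟩ ×
           C (suc i) (suc j) ≋ c ⊗ C i (suc j) × C i (suc j) ≋ C (suc i) j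
  step i j = f (i ℕ.+ j) , bezout i j , C-suc , C-swap
    where
    C-swap : C i (suc j) ≋ C (suc i) j
    C-swap = O.reflexive (cong (λ s → ∏ (s ℕ.∸ 1) f) (ℕ.+-suc i j))
    C-suc : C (suc i) (suc j) ≋ f (i ℕ.+ j) ⊗ C i (suc j)
    C-suc = O.trans (O.reflexive (cong (λ s → ∏ s f) (ℕ.+-suc i j)))
            (O.trans (O.*-comm (C (suc i) j) (f (i ℕ.+ j))) (O.*-congˡ {f (i ℕ.+ j)} (O.sym C-swap)))
  shift-high : ∀ i → shift (suc n ℕ.+ i) ≡ + p i
  shift-high i = trans (cong (λ x → + x - + (n ℕ.+ suc n)) (arith n i)) (i+j-j≡i (+ p i) (+ (n ℕ.+ suc n)))
    where
    arith : ∀ n i → 2 ℕ.* (suc n ℕ.+ i) ≡ suc (2 ℕ.* i) ℕ.+ (n ℕ.+ suc n)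
    arith = ℕ-RingSolver.solve-∀
  shift-low : ∀ i j → i ℕ.+ suc j ≡ suc n → shift i ≡ - (+ p j)
  shift-low i j q with ℕ.suc-injective (trans (sym (ℕ.+-suc i j)) q)
  ... | refl = trans (cong (λ x → + (2 ℕ.* i) - + x) (arith i j)) (i-[i+j]≡-j (+ (2 ℕ.* i)) (+ p j))
    where
    arith : ∀ i j → (i ℕ.+ j) ℕ.+ suc (i ℕ.+ j) ≡ 2 ℕ.* i ℕ.+ suc (2 ℕ.* j)
    arith = ℕ-RingSolver.solve-∀
  D₊ D₋ : Op
  D₊ = ∏ (suc n) (λ i → bin (+ p i) 1ℤ)
  D₋ = ∏ (suc n) (λ i → bin (- (+ p i)) 1ℤ)
  factorisation : ∏ (suc n ℕ.+ suc n) factor ≋ D₊ ⊗ 𝟙 ⊗ D₋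
  factorisation =
    O.trans (∏-+ (suc n) (suc n) factor)
    (O.trans (O.*-cong
        (∏-reverse (suc n) factor (λ i → bin (- (+ p i)) 1ℤ) (λ i j q → cong (λ x → bin x 1ℤ) (shift-low i j q)))
        (∏-cong (suc n) (λ i → cong (λ x → bin x 1ℤ) (shift-high i))))
    (O.trans (O.*-comm D₋ D₊) (O.*-congʳ {D₋} (O.sym (O.*-identityʳ D₊)))))

d-even : ∀ w → w % 2 ≡ 0 →
  d w ≡ (binom 0 1 · prodFrom1 w (λ i → binom 0 i)) · prodFrom1 (w / 2) (λ i → binom (2 ℕ.* i) 1)
d-even w p with w % 2
d-even w refl | .0 = refl

d-odd : ∀ w → w % 2 ≡ 1 →
  d w ≡ prodFrom1 w (λ i → binom 0 (2 ℕ.* i)) · prodFrom1 ((w ℕ.+ 1) / 2) (λ i → binom (2 ℕ.* i ℕ.∸ 1) 1)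
d-odd w p with w % 2
d-odd w refl | .1 = refl

toOp-d-even : ∀ w n → w ≡ n ℕ.+ n → w / 2 ≡ n → w % 2 ≡ 0 → toOp (d w) ≋ evenDenominator n
toOp-d-even w n refl half even = O.trans (O.reflexive (cong toOp (d-even w even)))
  (O.trans (toOp-· (binom 0 1 · prodFrom1 w (λ i → binom 0 i)) (prodFrom1 (w / 2) (λ i → binom (2 ℕ.* i) 1)))
  (O.trans (O.*-cong
      (O.trans (toOp-· (binom 0 1) (prodFrom1 w (λ i → binom 0 i)))
        (O.*-cong (toOp-binom 0 1)
          (toOp-prodFrom1 w (λ i → binom 0 i) (λ s → bin 0ℤ (+ suc s)) (λ i → toOp-binom 0 (suc i)))))
      (O.trans (O.reflexive (cong (λ m → toOp (prodFrom1 m (λ i → binom (2 ℕ.* i) 1))) half))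
        (toOp-prodFrom1 n (λ i → binom (2 ℕ.* i) 1) (λ i → bin (+ (2 ℕ.* suc i)) 1ℤ) (λ i → toOp-binom (2 ℕ.* suc i) 1))))
  (O.*-comm (bin 0ℤ 1ℤ ⊗ ∏ w (λ s → bin 0ℤ (+ suc s))) (∏ n (λ i → bin (+ (2 ℕ.* suc i)) 1ℤ)))))

toOp-d-odd : ∀ w n → w ≡ n ℕ.+ suc n → (w ℕ.+ 1) / 2 ≡ suc n → w % 2 ≡ 1 → toOp (d w) ≋ oddDenominator n
toOp-d-odd w n refl half odd = O.trans (O.reflexive (cong toOp (d-odd w odd)))
  (O.trans (toOp-· (prodFrom1 w (λ i → binom 0 (2 ℕ.* i))) (prodFrom1 ((w ℕ.+ 1) / 2) (λ i → binom (2 ℕ.* i ℕ.∸ 1) 1)))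
  (O.trans (O.*-cong
      (O.trans (toOp-prodFrom1 w (λ i → binom 0 (2 ℕ.* i)) f (λ i → toOp-binom 0 (2 ℕ.* suc i)))
               (O.sym (O.*-identityˡ (∏ w f))))
      (O.trans (O.reflexive (cong (λ m → toOp (prodFrom1 m (λ i → binom (2 ℕ.* i ℕ.∸ 1) 1))) half))
        (toOp-prodFrom1 (suc n) (λ i → binom (2 ℕ.* i ℕ.∸ 1) 1) (λ i → bin (+ suc (2 ℕ.* i)) 1ℤ)
          (λ i → O.trans (toOp-binom (2 ℕ.* suc i ℕ.∸ 1) 1)
            (O.reflexive (cong (λ x → bin (+ x) 1ℤ) (cong (ℕ._∸ 1) (ℕ.*-suc 2 i))))))))
  (O.*-comm (𝟙 ⊗ ∏ w f) (∏ (suc n) (λ i → bin (+ suc (2 ℕ.* i)) 1ℤ)))))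
  where
  f : ℕ → Op
  f s = bin 0ℤ (+ (2 ℕ.* suc s))

n*2≡n+n : ∀ n → n ℕ.* 2 ≡ n ℕ.+ n
n*2≡n+n = ℕ-RingSolver.solve-∀

d-bounded : ∀ w P → OrderInvariant P → Bounded (act (toOp (d w)) (π (act q-q⁻¹ (WordSeries.G w P w))))
d-bounded w P inv = cases (w % 2) refl (m%n<n w 2)
  where
  F = π (act q-q⁻¹ (WordSeries.G w P w))
  n = w / 2
  transport : ∀ {D} → toOp (d w) ≋ D → Bounded (act D F) → Bounded (act (toOp (d w)) F)
  transport p (b₁ , b₂) = Bdd-cong (λ e h → sym (ap p F e h)) b₁ , Bdd-cong (λ e h → sym (ap p F e h)) b₂
  cases : ∀ r → w % 2 ≡ r → r ℕ.< 2 → Bounded (act (toOp (d w)) F)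
  cases 0 even _ = transport (toOp-d-even w n w≡ refl even)
    (subst (λ w → Bounded (act (evenDenominator n) (π (act q-q⁻¹ (WordSeries.G w P w))))) (sym w≡) (even-bounded n P inv))
    where
    w≡ : w ≡ n ℕ.+ n
    w≡ = trans (m≡m%n+[m/n]*n w 2) (cong₂ ℕ._+_ even (n*2≡n+n n))
  cases 1 odd _ = transport (toOp-d-odd w n w≡ half odd)
    (subst (λ w → Bounded (act (oddDenominator n) (π (act q-q⁻¹ (WordSeries.G w P w))))) (sym w≡) (odd-bounded n P inv))
    where
    w≡ : w ≡ n ℕ.+ suc n
    w≡ = trans (m≡m%n+[m/n]*n w 2) (trans (cong₂ ℕ._+_ odd (n*2≡n+n n)) (sym (ℕ.+-suc n n)))
    half : (w ℕ.+ 1) / 2 ≡ suc n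
    half = trans (cong (_/ 2) (trans (cong (ℕ._+ 1) w≡) (arith n))) (m*n/n≡m (suc n) 2)
      where
      arith : ∀ n → n ℕ.+ suc n ℕ.+ 1 ≡ suc n ℕ.* 2
      arith = ℕ-RingSolver.solve-∀
  cases (suc (suc r)) _ (s≤s (s≤s ()))

theorem4p9 : (w : ℕ) → 0 < w → (μ : List ℕ) → IsPartitionOf w μ →
    (a : ℕ → ℕ → ℤ) → IsQIntExpansion μ a →
    IsPolynomial (mulSeriesCoeff (d w) (Acoeff a))
theorem4p9 w _ μ (refl , _) a exp with d-bounded w (isTableau μ) (isTableau-invariant μ)
-- Any natural exponent from `1 + ∣K∣ + ∣L∣` on exceeds both bounds, whatever their signs.
... | bdd K v , bdd L v′ = suc (∣ K ∣ ℕ.+ ∣ L ∣) , λ k h large → trans (rewriting k h) (vanish k h large)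
  where
  F = π (act q-q⁻¹ (WordSeries.G w (isTableau μ) w))
  rewriting : ∀ k h → mulSeriesCoeff (d w) (Acoeff a) k h ≡ act (toOp (d w)) F (+ k) (+ h)
  rewriting k h = trans (mulSeriesCoeff-act (d w) (Acoeff a) k h)
                        (act-cong (toOp (d w)) (extend-Acoeff μ a exp) (+ k) (+ h))
  first : ∀ x y → x ≡ 1ℤ * x + 0ℤ * y
  first = solve-∀
  second : ∀ x y → y ≡ 0ℤ * x + 1ℤ * y
  second = solve-∀
  vanish : ∀ k h → (suc (∣ K ∣ ℕ.+ ∣ L ∣) ℕ.≤ k ⊎ suc (∣ K ∣ ℕ.+ ∣ L ∣) ℕ.≤ h) → act (toOp (d w)) F (+ k) (+ h) ≡ 0ℤ
  vanish k h (inj₁ l) = v (+ k) (+ h)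
    (subst (K <ℤ_) (first (+ k) (+ h)) (≤-<-trans (i≤+∣i∣ K) (+<+ (ℕ.≤-trans (s≤s (ℕ.m≤m+n ∣ K ∣ ∣ L ∣)) l))))
  vanish k h (inj₂ l) = v′ (+ k) (+ h)
    (subst (L <ℤ_) (second (+ k) (+ h)) (≤-<-trans (i≤+∣i∣ L) (+<+ (ℕ.≤-trans (s≤s (ℕ.m≤n+m ∣ L ∣ ∣ K ∣)) l))))
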